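{- All six inference rules of the calculus $\mathrm{G}^3\text{\L}\forall$ are hp-invertible (height-preserving invertible) in $\mathrm{G}^3\text{\L}\forall$.
   Context: Syntax. Fix a signature of predicate and function symbols of arbitrary nonnegative arities that includes a countable set of nullary function symbols called parameters (there are infinitely many of them). Terms are standard. Atomic $\mathrm{RPL}\forall$-formulas are $P(t_1,\dots,t_n)$ ($P$ a predicate symbol, $t_i$ terms) and truth constants $\bar r$ for rational $r\in[0,1]$. $\mathrm{RPL}\forall$-formulas are built from these using the logical symbols $\to$ (binary), $\forall$, $\exists$. $[A]^x_t$ is the result of substituting $t$ for all free occurrences of the variable $x$ in $A$. In addition there are countably (infinitely) many semipropositional variables of type 1, and countably (infinitely) many semipropositional variables of type 0. A formula is an $\mathrm{RPL}\forall$-formula or a semipropositional variable (so semipropositional variables do not occur inside compound formulas). An atom is an atomic $\mathrm{RPL}\forall$-formula or a semipropositional variable. A sequent $\Gamma\Rightarrow\Delta$ is an ordered pair of finite multisets of formulas (its members); it is atomic if all its members are atoms. A hypersequent $S_1\,|\,\cdots\,|\,S_n$ is a finite multiset of sequents. Semantics (needed for axioms). An hs-interpretation $M=\langle\mathcal{D},\mu\rangle$ has a nonempty domain $\mathcal{D}$; $\mu$ interprets $n$-ary function symbols by functions $\mathcal{D}^n\to\mathcal{D}$, $n$-ary predicate symbols by maps $\mathcal{D}^n\to[0,1]$, each semipropositional variable of type 0 by a real in $[0,+\infty)$, and each of type 1 by a real in $(-\infty,1]$. A valuation $\nu$ maps individual variables to $\mathcal{D}$. For atoms: $|\bar r|_{M,\nu}=r$;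 $|P(t_1,\dots,t_n)|_{M,\nu}=\mu(P)(|t_1|_{M,\nu},\dots,|t_n|_{M,\nu})$; a semipropositional variable has the value given by $\mu$. For a finite multiset $\Gamma$ of atoms, $|\Gamma|_{M,\nu}=\sum_{F\in\Gamma}(|F|_{M,\nu}-1)$ (with multiplicity; $0$ if $\Gamma$ is empty). An atomic sequent $\Gamma\Rightarrow\Delta$ is true under $M,\nu$ if $|\Delta|_{M,\nu}-|\Gamma|_{M,\nu}\geqslant0$. Calculus $\mathrm{G}^3\text{\L}\forall$. Axioms: all hypersequents in which, for every hs-interpretation $M$ and valuation $\nu$, there is an atomic sequent true under $M$ and $\nu$. Rules (premises / conclusion), with $A,B$ $\mathrm{RPL}\forall$-formulas, $\Gamma,\Delta$ finite multisets of formulas, $\mathcal{G}$ a (possibly empty) hypersequent: $(\to\Rightarrow)^3$: $\mathcal{G}\,|\,\Gamma,\mathfrak{p}\Rightarrow\Delta\,|\,B\Rightarrow\mathfrak{p},A$ / $\mathcal{G}\,|\,\Gamma,A\to B\Rightarrow\Delta$; $(\Rightarrow\to)^3$: $\mathcal{G}\,|\,\Gamma\Rightarrow\Delta$ and $\mathcal{G}\,|\,\Gamma,A\Rightarrow B,\Delta$ / $\mathcal{G}\,|\,\Gamma\Rightarrow A\to B,\Delta$; $(\forall\Rightarrow)^3$: $\mathcal{G}\,|\,\Gamma,\mathfrak{p}\Rightarrow\Delta\,|\,\forall xA\Rightarrow\mathfrak{p}\,|\,[A]^x_t\Rightarrow\mathfrak{p}$ / $\mathcal{G}\,|\,\Gamma,\forall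 xA\Rightarrow\Delta$; $(\Rightarrow\forall)^3$: $\mathcal{G}\,|\,\Gamma\Rightarrow[A]^x_a,\Delta$ / $\mathcal{G}\,|\,\Gamma\Rightarrow\forall xA,\Delta$; $(\Rightarrow\exists)^3$: $\mathcal{G}\,|\,\Gamma\Rightarrow\mathfrak{q},\Delta\,|\,\mathfrak{q}\Rightarrow\exists xA\,|\,\mathfrak{q}\Rightarrow[A]^x_t$ / $\mathcal{G}\,|\,\Gamma\Rightarrow\exists xA,\Delta$; $(\exists\Rightarrow)^3$: $\mathcal{G}\,|\,\Gamma,[A]^x_a\Rightarrow\Delta$ / $\mathcal{G}\,|\,\Gamma,\exists xA\Rightarrow\Delta$. Here $\mathfrak{p}$ (type 1) and $\mathfrak{q}$ (type 0) are semipropositional variables not occurring in the conclusion, $t$ is a closed term, and $a$ is a parameter not occurring in the conclusion. Proofs are finite trees of hypersequents built by the rules with all leaves axioms. $h(D)$ denotes the height of a proof $D$ (a single axiom has height $0$). A rule is hp-admissible for a calculus if, for each application $\mathcal{H}_1;\dots;\mathcal{H}_k/\mathcal{H}$ of the rule and all proofs $D_1$ of $\mathcal{H}_1$, ..., $D_k$ of $\mathcal{H}_k$ in the calculus, there exists (and can be constructed from the $D_i$) a proof $D$ of $\mathcal{H}$ with $h(D)\leqslant\max\{h(D_1),\dots,h(D_k)\}$. A $k$-premise rule $\mathcal{R}$ is hp-invertible in a calculus if, for each $i=1,\dots,k$, the rule $\{\langle\mathcal{H},\mathcal{H}_i\rangle\mid\langle\mathcal{H}_1,\dots,\mathcal{H}_k,\mathcal{H}\rangle\in\mathcal{R}\}$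 (premise $\mathcal{H}$, conclusion $\mathcal{H}_i$) is hp-admissible for the calculus. -}

module Defs where

open import Algebra.Bundles using (CommutativeMonoid)
import Algebra.Properties.CommutativeSemigroup as CommutativeSemigroupProperties
open import Data.Bool.Base using (if_then_else_)
open import Data.Empty using (⊥)
open import Data.Fin.Base using (Fin)
open import Data.List.Base using (List; []; _∷_; foldr)
open import Data.List.Relation.Unary.All using (All; reduce)
open import Data.List.Relation.Unary.Any using (Any)
open import Data.List.Relation.Binary.Permutation.Propositional using (↭-setoid)
import Data.List.Relation.Binary.Permutation.Setoid as PermutationSetoid
open import Data.Nat.Base as ℕ using (ℕ; suc; _⊔_)
import Data.Nat.Properties as ℕ
open import Data.Product.Base using (Σ; ∃-syntax; _×_; _,_)
open import Data.Product.Relation.Binary.Pointwise.NonDependent using (×-setoid)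
open import Data.Rational.Base as ℚ using (ℚ; 0ℚ; 1ℚ; ½; ∣_∣)
import Data.Rational.Properties as ℚ
open import Data.Sum.Base using (_⊎_)
open import Data.Vec.Base using (Vec; []; _∷_; head; lookup)
open import Data.Vec.Relation.Unary.All as VecAll using ()
open import Data.Vec.Relation.Unary.Any as VecAny using ()
open import Data.Vec.Relation.Binary.Pointwise.Inductive using (Pointwise)
open import Level using (0ℓ)
open import Relation.Binary.Bundles using (Setoid)
open import Relation.Binary.PropositionalEquality
  using (_≡_; sym; trans; cong; subst)
open import Relation.Nullary using (¬_; does)

------------------------------------------------------------------------
-- Real numbers, as Cauchy sequences of rationals

record ℝ : Set where
  constructor mkℝ
  field
    seq    : ℕ → ℚ
    cauchy : ∀ ε → 0ℚ ℚ.< ε →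
             ∃[ N ] (∀ m n → N ℕ.≤ m → N ℕ.≤ n → ∣ seq m ℚ.- seq n ∣ ℚ.< ε)

open ℝ public

infix  4 _≤ᴿ_
infixl 6 _+ᴿ_ _-ᴿ_
infix  8 -ᴿ_

_≤ᴿ_ : ℝ → ℝ → Set
x ≤ᴿ y = ∀ ε → 0ℚ ℚ.< ε → ∃[ N ] (∀ n → N ℕ.≤ n → seq x n ℚ.≤ seq y n ℚ.+ ε)

fromℚ : ℚ → ℝ
fromℚ q = mkℝ (λ _ → q) λ ε 0<ε → 0 , λ _ _ _ _ →
  subst (ℚ._< ε) (sym (cong ∣_∣ (ℚ.+-inverseʳ q))) 0<ε

0ᴿ 1ᴿ : ℝ
0ᴿ = fromℚ 0ℚ
1ᴿ = fromℚ 1ℚ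

private
  half-pos : ∀ {ε} → 0ℚ ℚ.< ε → 0ℚ ℚ.< ½ ℚ.* ε
  half-pos {ε} 0<ε =
    subst (ℚ._< ½ ℚ.* ε) (ℚ.*-zeroʳ ½) (ℚ.*-monoʳ-<-pos ½ 0<ε)

  half+half : ∀ ε → ½ ℚ.* ε ℚ.+ ½ ℚ.* ε ≡ ε
  half+half ε = trans (sym (ℚ.*-distribʳ-+ ε ½ ½)) (ℚ.*-identityˡ ε)

  +-interchange : ∀ a b c d → (a ℚ.+ b) ℚ.+ (c ℚ.+ d) ≡ (a ℚ.+ c) ℚ.+ (b ℚ.+ d)
  +-interchange = CommutativeSemigroupProperties.interchange
    (CommutativeMonoid.commutativeSemigroup ℚ.+-0-commutativeMonoid)

-ᴿ_ : ℝ → ℝ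
-ᴿ x = mkℝ (λ n → ℚ.- seq x n) λ ε 0<ε → let N , p = cauchy x ε 0<ε in
  N , λ m n N≤m N≤n → subst (ℚ._< ε)
    (trans (sym (ℚ.∣-p∣≡∣p∣ (seq x m ℚ.- seq x n)))
           (cong ∣_∣ (ℚ.neg-distrib-+ (seq x m) (ℚ.- seq x n))))
    (p m n N≤m N≤n)

_+ᴿ_ : ℝ → ℝ → ℝ
x +ᴿ y = mkℝ (λ n → seq x n ℚ.+ seq y n) λ ε 0<ε →
  let M , p = cauchy x (½ ℚ.* ε) (half-pos 0<ε)
      N , q = cauchy y (½ ℚ.* ε) (half-pos 0<ε)
  in M ⊔ N , λ m n l l′ →
    let a = seq x m; b = seq y m; c = seq x n; d = seq y n
        regroup = trans (+-interchange a (ℚ.- c) b (ℚ.- d))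
                        (cong ((a ℚ.+ b) ℚ.+_) (sym (ℚ.neg-distrib-+ c d)))
        bound = ℚ.≤-<-trans (ℚ.∣p+q∣≤∣p∣+∣q∣ (a ℚ.- c) (b ℚ.- d))
          (ℚ.+-mono-<
            (p m n (ℕ.≤-trans (ℕ.m≤m⊔n M N) l) (ℕ.≤-trans (ℕ.m≤m⊔n M N) l′))
            (q m n (ℕ.≤-trans (ℕ.m≤n⊔m M N) l) (ℕ.≤-trans (ℕ.m≤n⊔m M N) l′)))
    in subst (ℚ._< ε) (cong ∣_∣ regroup)
         (subst (∣ (a ℚ.- c) ℚ.+ (b ℚ.- d) ∣ ℚ.<_) (half+half ε) bound)

_-ᴿ_ : ℝ → ℝ → ℝ
x -ᴿ y = x +ᴿ (-ᴿ y)

sumᴿ : List ℝ → ℝ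
sumᴿ = foldr _+ᴿ_ 0ᴿ

------------------------------------------------------------------------
-- Syntax

-- The parameters p₀, p₁, … are nullary function symbols of every signature;
-- FunSym lists the remaining function symbols.
record Signature : Set₁ where
  field
    PredSym   : Set
    predArity : PredSym → ℕ
    FunSym    : Set
    funArity  : FunSym → ℕ

record Rational01 : Set where
  constructor rational01
  field
    value  : ℚ
    .lower : 0ℚ ℚ.≤ value
    .upper : value ℚ.≤ 1ℚ

Var Param : Set
Var   = ℕ
Param = ℕ

data SPVar : Set where
  type1 : ℕ → SPVar
  type0 : ℕ → SPVar

module _ (𝒮 : Signature) where
  open Signature 𝒮

  data Term : Set where
    var   : Var → Term
    param : Param → Term
    fun   : (f : FunSym) → Vec Term (funArity f) → Term

  infixr 5 _⊃_

  data RPL∀ : Set where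
    pred   : (P : PredSym) → Vec Term (predArity P) → RPL∀
    const  : Rational01 → RPL∀
    _⊃_    : RPL∀ → RPL∀ → RPL∀
    forall′ exists′ : Var → RPL∀ → RPL∀

  data Formula : Set where
    rpl : RPL∀ → Formula
    sp  : SPVar → Formula

module _ {𝒮 : Signature} where
  open Signature 𝒮

  data VarIn (x : Var) : Term 𝒮 → Set where
    var : VarIn x (var x)
    fun : ∀ {f ts} → VecAny.Any (VarIn x) ts → VarIn x (fun f ts)

  Closed : Term 𝒮 → Set
  Closed t = ∀ x → ¬ VarIn x t

  module _ (x : Var) (t : Term 𝒮) where
    substTerm : Term 𝒮 → Term 𝒮
    substTerms : ∀ {n} → Vec (Term 𝒮) n → Vec (Term 𝒮) n

    substTerm (var y)    = if does (x ℕ.≟ y) then t else var y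
    substTerm (param a)  = param a
    substTerm (fun f ts) = fun f (substTerms ts)

    substTerms []       = []
    substTerms (s ∷ ss) = substTerm s ∷ substTerms ss

  -- Literal replacement of the free occurrences of x.  Only closed t are ever
  -- substituted in the calculus, so no variable can be captured.
  infix 8 _[_≔_]
  _[_≔_] : RPL∀ 𝒮 → Var → Term 𝒮 → RPL∀ 𝒮
  pred P ts   [ x ≔ t ] = pred P (substTerms x t ts)
  const r     [ x ≔ t ] = const r
  (A ⊃ B)     [ x ≔ t ] = A [ x ≔ t ] ⊃ B [ x ≔ t ]
  forall′ y A [ x ≔ t ] = forall′ y (if does (x ℕ.≟ y) then A else A [ x ≔ t ])
  exists′ y A [ x ≔ t ] = exists′ y (if does (x ℕ.≟ y) then A else A [ x ≔ t ])

  data ParamInTerm (a : Param) : Term 𝒮 → Set where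
    param : ParamInTerm a (param a)
    fun   : ∀ {f ts} → VecAny.Any (ParamInTerm a) ts → ParamInTerm a (fun f ts)

  ParamInRPL∀ : Param → RPL∀ 𝒮 → Set
  ParamInRPL∀ a (pred P ts)   = VecAny.Any (ParamInTerm a) ts
  ParamInRPL∀ a (const r)     = ⊥
  ParamInRPL∀ a (A ⊃ B)       = ParamInRPL∀ a A ⊎ ParamInRPL∀ a B
  ParamInRPL∀ a (forall′ x A) = ParamInRPL∀ a A
  ParamInRPL∀ a (exists′ x A) = ParamInRPL∀ a A

  ParamIn : Param → Formula 𝒮 → Set
  ParamIn a (rpl A) = ParamInRPL∀ a A
  ParamIn a (sp v)  = ⊥

  data IsAtom : Formula 𝒮 → Set where
    pred  : ∀ P ts → IsAtom (rpl (pred P ts))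
    const : ∀ r → IsAtom (rpl (const r))
    sp    : ∀ v → IsAtom (sp v)

------------------------------------------------------------------------
-- Sequents and hypersequents
--
-- Finite multisets are lists, compared up to permutation (_≋_ below).

module _ (𝒮 : Signature) where

  Sequent : Set
  Sequent = List (Formula 𝒮) × List (Formula 𝒮)

  Hypersequent : Set
  Hypersequent = List Sequent

  sequentSetoid : Setoid 0ℓ 0ℓ
  sequentSetoid = ×-setoid (↭-setoid {A = Formula 𝒮}) (↭-setoid {A = Formula 𝒮})

infix 4 _⇒_
pattern _⇒_ Γ Δ = Γ , Δ

module _ {𝒮 : Signature} where

  infix 3 _≋_
  _≋_ : Hypersequent 𝒮 → Hypersequent 𝒮 → Set
  _≋_ = PermutationSetoid._↭_ (sequentSetoid 𝒮)

  Somewhere : (Formula 𝒮 → Set) → Hypersequent 𝒮 → Set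
  Somewhere P = Any λ (Γ , Δ) → Any P Γ ⊎ Any P Δ

  infix 4 _♯ˢ_ _♯ᵖ_

  -- Nonoccurrence of a semipropositional variable / parameter.
  _♯ˢ_ : SPVar → Hypersequent 𝒮 → Set
  v ♯ˢ H = ¬ Somewhere (sp v ≡_) H

  _♯ᵖ_ : Param → Hypersequent 𝒮 → Set
  a ♯ᵖ H = ¬ Somewhere (ParamIn a) H

------------------------------------------------------------------------
-- Semantics

record HsInterpretation (𝒮 : Signature) : Set₁ where
  open Signature 𝒮
  field
    Domain  : Set
    element : Domain
    ⟦param⟧ : Param → Domain
    ⟦fun⟧   : (f : FunSym) → Vec Domain (funArity f) → Domain
    ⟦pred⟧  : (P : PredSym) → Vec Domain (predArity P) → ℝ
    pred≥0  : ∀ P ds → 0ᴿ ≤ᴿ ⟦pred⟧ P ds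
    pred≤1  : ∀ P ds → ⟦pred⟧ P ds ≤ᴿ 1ᴿ
    ⟦sp⟧    : SPVar → ℝ
    type0≥0 : ∀ n → 0ᴿ ≤ᴿ ⟦sp⟧ (type0 n)
    type1≤1 : ∀ n → ⟦sp⟧ (type1 n) ≤ᴿ 1ᴿ

module _ {𝒮 : Signature} (M : HsInterpretation 𝒮) where
  open HsInterpretation M

  Valuation : Set
  Valuation = Var → Domain

  module _ (ν : Valuation) where

    ⟦_⟧ᵗ : Term 𝒮 → Domain
    ⟦_⟧ᵗˢ : ∀ {n} → Vec (Term 𝒮) n → Vec Domain n

    ⟦ var x ⟧ᵗ    = ν x
    ⟦ param a ⟧ᵗ  = ⟦param⟧ a
    ⟦ fun f ts ⟧ᵗ = ⟦fun⟧ f ⟦ ts ⟧ᵗˢ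

    ⟦ [] ⟧ᵗˢ     = []
    ⟦ t ∷ ts ⟧ᵗˢ = ⟦ t ⟧ᵗ ∷ ⟦ ts ⟧ᵗˢ

    atomValue : ∀ {F} → IsAtom F → ℝ
    atomValue (pred P ts) = ⟦pred⟧ P ⟦ ts ⟧ᵗˢ
    atomValue (const r)   = fromℚ (Rational01.value r)
    atomValue (sp v)      = ⟦sp⟧ v

    multisetValue : ∀ {Γ} → All IsAtom Γ → ℝ
    multisetValue αs = sumᴿ (reduce (λ α → atomValue α -ᴿ 1ᴿ) αs)

    TrueAtomic : Sequent 𝒮 → Set
    TrueAtomic (Γ ⇒ Δ) = Σ (All IsAtom Γ) λ αs → Σ (All IsAtom Δ) λ βs →
      0ᴿ ≤ᴿ multisetValue βs -ᴿ multisetValue αs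

-- The existence of a true atomic sequent is meant classically, whence ¬ ¬:
-- constructively one cannot decide which of p ⇒ q and q ⇒ p is true.
IsAxiom : ∀ {𝒮} → Hypersequent 𝒮 → Set₁
IsAxiom {𝒮} H =
  (M : HsInterpretation 𝒮) (ν : Valuation M) → ¬ ¬ Any (TrueAtomic M ν) H

------------------------------------------------------------------------
-- Rules, calculi, proofs

-- A k-premise rule is the set of its applications.
Rule : Signature → ℕ → Set₁
Rule 𝒮 k = Vec (Hypersequent 𝒮) k → Hypersequent 𝒮 → Set

module _ {𝒮 : Signature} where

  -- Applications of a rule whose schema is given on list representatives.
  OnMultisets : ∀ {k} → Rule 𝒮 k → Rule 𝒮 k
  OnMultisets R Hs H =
    ∃[ Hs′ ] ∃[ H′ ] R Hs′ H′ × Pointwise _≋_ Hs Hs′ × H ≋ H′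

  Inverse : ∀ {k} → Rule 𝒮 k → Fin k → Rule 𝒮 1
  Inverse R i Hs Hᵢ = ∃[ Hs′ ] R Hs′ (head Hs) × lookup Hs′ i ≡ Hᵢ

record Calculus (𝒮 : Signature) : Set₂ where
  field
    Axiom    : Hypersequent 𝒮 → Set₁
    RuleName : Set
    arity    : RuleName → ℕ
    rule     : (r : RuleName) → Rule 𝒮 (arity r)

module _ {𝒮 : Signature} (𝒞 : Calculus 𝒮) where
  open Calculus 𝒞

  data Proof : Hypersequent 𝒮 → Set₁ where
    axiom : ∀ {H} → Axiom H → Proof H
    infer : ∀ r {Hs H} → rule r Hs H → VecAll.All Proof Hs → Proof H

  height : ∀ {H} → Proof H → ℕ
  maxHeight : ∀ {k} {Hs : Vec (Hypersequent 𝒮) k} → VecAll.All Proof Hs → ℕ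

  height (axiom _)      = 0
  height (infer _ _ Ds) = suc (maxHeight Ds)

  maxHeight VecAll.[]       = 0
  maxHeight (D VecAll.∷ Ds) = height D ⊔ maxHeight Ds

  HpAdmissible : ∀ {k} → Rule 𝒮 k → Set₁
  HpAdmissible R = ∀ {Hs H} → R Hs H → (Ds : VecAll.All Proof Hs) →
    Σ (Proof H) λ D → height D ℕ.≤ maxHeight Ds

  HpInvertible : ∀ {k} → Rule 𝒮 k → Set₁
  HpInvertible R = ∀ i → HpAdmissible (Inverse R i)

------------------------------------------------------------------------
-- The calculus G³Ł∀

data G³Ł∀Rule : Set where
  →⇒ ⇒→ ∀⇒ ⇒∀ ⇒∃ ∃⇒ : G³Ł∀Rule

G³Ł∀-arity : G³Ł∀Rule → ℕ
G³Ł∀-arity →⇒ = 1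
G³Ł∀-arity ⇒→ = 2
G³Ł∀-arity ∀⇒ = 1
G³Ł∀-arity ⇒∀ = 1
G³Ł∀-arity ⇒∃ = 1
G³Ł∀-arity ∃⇒ = 1

data Schema {𝒮 : Signature} : (r : G³Ł∀Rule) → Rule 𝒮 (G³Ł∀-arity r) where

  →⇒ : ∀ G Γ Δ A B p (let 𝔭 = type1 p
                          H = (rpl (A ⊃ B) ∷ Γ ⇒ Δ) ∷ G) →
    𝔭 ♯ˢ H →
    Schema →⇒ (((sp 𝔭 ∷ Γ ⇒ Δ) ∷ (rpl B ∷ [] ⇒ sp 𝔭 ∷ rpl A ∷ []) ∷ G) ∷ []) H

  ⇒→ : ∀ G Γ Δ A B →
    Schema ⇒→ (((Γ ⇒ Δ) ∷ G) ∷ ((rpl A ∷ Γ ⇒ rpl B ∷ Δ) ∷ G) ∷ [])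
              ((Γ ⇒ rpl (A ⊃ B) ∷ Δ) ∷ G)

  ∀⇒ : ∀ G Γ Δ x A t p (let 𝔭 = type1 p
                            H = (rpl (forall′ x A) ∷ Γ ⇒ Δ) ∷ G) →
    Closed t → 𝔭 ♯ˢ H →
    Schema ∀⇒ (((sp 𝔭 ∷ Γ ⇒ Δ) ∷
                (rpl (forall′ x A) ∷ [] ⇒ sp 𝔭 ∷ []) ∷
                (rpl (A [ x ≔ t ]) ∷ [] ⇒ sp 𝔭 ∷ []) ∷ G) ∷ []) H

  ⇒∀ : ∀ G Γ Δ x A a (let H = (Γ ⇒ rpl (forall′ x A) ∷ Δ) ∷ G) →
    a ♯ᵖ H →
    Schema ⇒∀ (((Γ ⇒ rpl (A [ x ≔ param a ]) ∷ Δ) ∷ G) ∷ []) H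

  ⇒∃ : ∀ G Γ Δ x A t q (let 𝔮 = type0 q
                            H = (Γ ⇒ rpl (exists′ x A) ∷ Δ) ∷ G) →
    Closed t → 𝔮 ♯ˢ H →
    Schema ⇒∃ (((Γ ⇒ sp 𝔮 ∷ Δ) ∷
                (sp 𝔮 ∷ [] ⇒ rpl (exists′ x A) ∷ []) ∷
                (sp 𝔮 ∷ [] ⇒ rpl (A [ x ≔ t ]) ∷ []) ∷ G) ∷ []) H

  ∃⇒ : ∀ G Γ Δ x A a (let H = (rpl (exists′ x A) ∷ Γ ⇒ Δ) ∷ G) →
    a ♯ᵖ H →
    Schema ∃⇒ (((rpl (A [ x ≔ param a ]) ∷ Γ ⇒ Δ) ∷ G) ∷ []) H

G³Ł∀ : (𝒮 : Signature) → Calculus 𝒮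
G³Ł∀ 𝒮 = record
  { Axiom    = IsAxiom
  ; RuleName = G³Ł∀Rule
  ; arity    = G³Ł∀-arity
  ; rule     = λ r → OnMultisets (Schema r)
  }

{-# OPTIONS --safe #-}

-- Given a proof of G | Γ,Γ′ ⇒ Δ,Δ′ and any semipropositional variable v, there is
-- a proof of G | Γ ⇒ v,Δ | v,Γ′ ⇒ Δ′ of no greater height: on axioms, the
-- contributions of the two occurrences of v cancel, so one of the two new sequents is
-- true, and every rule permutes with the splitting.  Splitting off the principal
-- formula, followed by weakening, inverts (∀⇒)³ and (⇒∃)³, whose premises depend on an
-- arbitrary closed term.  The premises of the other four rules are determined by the
-- principal formula up to renaming of the eigenvariable, so the usual inductive
-- inversion applies to them.  To keep eigenvariables fresh, renaming of parameters and
-- semipropositional variables and weakening are built into the same induction.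

module Submission where

open import Defs
import Algebra.Solver.CommutativeMonoid as CommutativeMonoidSolver
open import Data.Bool.Base using (true; false)
open import Data.Empty using (⊥)
open import Data.Fin.Base using (Fin; zero; suc)
open import Data.List.Base using (List; []; _∷_; _++_; map)
import Data.List.Properties as List
open import Data.List.Relation.Binary.Permutation.Propositional as ↭
  using (_↭_; ↭-sym; ↭-trans; ↭-prep; ↭-swap; ↭⇒↭ₛ; ↭ₛ⇒↭)
import Data.List.Relation.Binary.Permutation.Propositional.Properties as ↭
import Data.List.Relation.Binary.Permutation.Setoid as PermutationSetoid
import Data.List.Relation.Binary.Permutation.Setoid.Properties as PermutationSetoidProperties
open import Data.List.Relation.Unary.All as All using (All; []; _∷_)
import Data.List.Relation.Unary.All.Properties as All
open import Data.List.Relation.Unary.Any as Any using (Any; here; there)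
import Data.List.Relation.Unary.Any.Properties as Any
open import Data.Nat.Base as ℕ using (ℕ; suc; _⊔_)
import Data.Nat.Properties as ℕ
open import Data.Product.Base using (Σ; ∃-syntax; _×_; _,_; proj₁; proj₂)
open import Data.Rational.Base as ℚ using (0ℚ; ½)
import Data.Rational.Properties as ℚ
open import Data.Rational.Solver using (module +-*-Solver)
open import Data.Sum.Base as Sum using (_⊎_; inj₁; inj₂; [_,_]′)
open import Data.Unit.Base using (⊤; tt)
open import Data.Vec.Base as Vec using (Vec; []; _∷_; lookup)
import Data.Vec.Properties as Vec
import Data.Vec.Relation.Binary.Pointwise.Inductive as Pointwise
open import Data.Vec.Relation.Unary.All as VecAll using ([]; _∷_)
open import Data.Vec.Relation.Unary.Any as VecAny using (here; there)
open import Function.Base using (_∘_; id)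
open import Relation.Binary.Bundles using (Setoid)
import Relation.Binary.PropositionalEquality as ≡
open import Relation.Binary.PropositionalEquality
  using (_≡_; refl; sym; trans; cong; cong₂; subst; subst₂)
open import Relation.Nullary using (¬_; Dec; yes; no; does)
open import Relation.Nullary.Negation using (contradiction)

open +-*-Solver using (solve; con; _:+_; _:-_; _:*_; :-_; _:=_)

-- Renaming of parameters and semipropositional variables

data Kind : Set where
  paramᵏ type1ᵏ type0ᵏ : Kind

_≟ᵏ_ : (k k′ : Kind) → Dec (k ≡ k′)
paramᵏ ≟ᵏ paramᵏ = yes refl
paramᵏ ≟ᵏ type1ᵏ = no λ ()
paramᵏ ≟ᵏ type0ᵏ = no λ ()
type1ᵏ ≟ᵏ paramᵏ = no λ ()
type1ᵏ ≟ᵏ type1ᵏ = yes refl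
type1ᵏ ≟ᵏ type0ᵏ = no λ ()
type0ᵏ ≟ᵏ paramᵏ = no λ ()
type0ᵏ ≟ᵏ type1ᵏ = no λ ()
type0ᵏ ≟ᵏ type0ᵏ = yes refl

-- An arbitrary map of indices, kind by kind. Even one that identifies symbols preserves axioms,
-- because interpretations can be pulled back along it.
Renaming : Set
Renaming = Kind → ℕ → ℕ

idʳ : Renaming
idʳ _ e = e

_[_,_↦_] : Renaming → Kind → ℕ → ℕ → Renaming
(ρ [ k , e ↦ e′ ]) k₁ e₁ with k ≟ᵏ k₁ | e ℕ.≟ e₁
... | yes _ | yes _ = e′
... | _     | _     = ρ k₁ e₁

update-same : ∀ ρ k e e′ → (ρ [ k , e ↦ e′ ]) k e ≡ e′
update-same ρ k e e′ with k ≟ᵏ k | e ℕ.≟ e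
... | yes _ | yes _ = refl
... | no k≢ | _     = contradiction refl k≢
... | yes _ | no e≢ = contradiction refl e≢

update-other : ∀ ρ k e e′ {k₁ e₁} → ¬ (k ≡ k₁ × e ≡ e₁) →
               (ρ [ k , e ↦ e′ ]) k₁ e₁ ≡ ρ k₁ e₁
update-other ρ k e e′ {k₁} {e₁} ≢ with k ≟ᵏ k₁ | e ℕ.≟ e₁
... | yes p | yes q = contradiction (p , q) ≢
... | no _  | _     = refl
... | yes _ | no _  = refl

renSP : Renaming → SPVar → SPVar
renSP ρ (type1 p) = type1 (ρ type1ᵏ p)
renSP ρ (type0 q) = type0 (ρ type0ᵏ q)

module _ {𝒮 : Signature} where
  open Signature 𝒮

  module _ (τ : Param → Param) where
    renTerm : Term 𝒮 → Term 𝒮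
    renTerms : ∀ {n} → Vec (Term 𝒮) n → Vec (Term 𝒮) n

    renTerm (var x)    = var x
    renTerm (param a)  = param (τ a)
    renTerm (fun f ts) = fun f (renTerms ts)

    renTerms []       = []
    renTerms (t ∷ ts) = renTerm t ∷ renTerms ts

    renTerm-subst : ∀ x t s →
      renTerm (substTerm x t s) ≡ substTerm x (renTerm t) (renTerm s)
    renTerms-subst : ∀ x t {n} (ss : Vec (Term 𝒮) n) →
      renTerms (substTerms x t ss) ≡ substTerms x (renTerm t) (renTerms ss)

    renTerm-subst x t (var y) with does (x ℕ.≟ y)
    ... | true  = refl
    ... | false = refl
    renTerm-subst x t (param a)  = refl
    renTerm-subst x t (fun f ss) = cong (fun f) (renTerms-subst x t ss)

    renTerms-subst x t []       = refl
    renTerms-subst x t (s ∷ ss) =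
      cong₂ _∷_ (renTerm-subst x t s) (renTerms-subst x t ss)

    VarIn-renTerm⁻ : ∀ {x} t → VarIn x (renTerm t) → VarIn x t
    VarIn-renTerms⁻ : ∀ {x n} (ts : Vec (Term 𝒮) n) →
      VecAny.Any (VarIn x) (renTerms ts) → VecAny.Any (VarIn x) ts

    VarIn-renTerm⁻ (var x)    var     = var
    VarIn-renTerm⁻ (fun f ts) (fun p) = fun (VarIn-renTerms⁻ ts p)

    VarIn-renTerms⁻ (t ∷ ts) (here p)  = here (VarIn-renTerm⁻ t p)
    VarIn-renTerms⁻ (t ∷ ts) (there p) = there (VarIn-renTerms⁻ ts p)

    Closed-renTerm : ∀ {t} → Closed t → Closed (renTerm t)
    Closed-renTerm {t} cl x p = cl x (VarIn-renTerm⁻ t p)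

    renRPL : RPL∀ 𝒮 → RPL∀ 𝒮
    renRPL (pred P ts)   = pred P (renTerms ts)
    renRPL (const r)     = const r
    renRPL (A ⊃ B)       = renRPL A ⊃ renRPL B
    renRPL (forall′ x A) = forall′ x (renRPL A)
    renRPL (exists′ x A) = exists′ x (renRPL A)

    renRPL-subst : ∀ A x t → renRPL (A [ x ≔ t ]) ≡ renRPL A [ x ≔ renTerm t ]
    renRPL-subst (pred P ts) x t = cong (pred P) (renTerms-subst x t ts)
    renRPL-subst (const r)   x t = refl
    renRPL-subst (A ⊃ B)     x t = cong₂ _⊃_ (renRPL-subst A x t) (renRPL-subst B x t)
    renRPL-subst (forall′ y A) x t with does (x ℕ.≟ y)
    ... | true  = refl
    ... | false = cong (forall′ y) (renRPL-subst A x t)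
    renRPL-subst (exists′ y A) x t with does (x ℕ.≟ y)
    ... | true  = refl
    ... | false = cong (exists′ y) (renRPL-subst A x t)

  renTerm-id : ∀ t → renTerm id t ≡ t
  renTerms-id : ∀ {n} (ts : Vec (Term 𝒮) n) → renTerms id ts ≡ ts

  renTerm-id (var x)    = refl
  renTerm-id (param a)  = refl
  renTerm-id (fun f ts) = cong (fun f) (renTerms-id ts)

  renTerms-id []       = refl
  renTerms-id (t ∷ ts) = cong₂ _∷_ (renTerm-id t) (renTerms-id ts)

  renRPL-id : ∀ A → renRPL id A ≡ A
  renRPL-id (pred P ts)   = cong (pred P) (renTerms-id ts)
  renRPL-id (const r)     = refl
  renRPL-id (A ⊃ B)       = cong₂ _⊃_ (renRPL-id A) (renRPL-id B)
  renRPL-id (forall′ x A) = cong (forall′ x) (renRPL-id A)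
  renRPL-id (exists′ x A) = cong (exists′ x) (renRPL-id A)

  module _ {τ τ′ : Param → Param} where
    renTerm-cong : ∀ t → (∀ a → ParamInTerm a t → τ a ≡ τ′ a) →
                   renTerm τ t ≡ renTerm τ′ t
    renTerms-cong : ∀ {n} (ts : Vec (Term 𝒮) n) →
                    (∀ a → VecAny.Any (ParamInTerm a) ts → τ a ≡ τ′ a) →
                    renTerms τ ts ≡ renTerms τ′ ts

    renTerm-cong (var x)    eq = refl
    renTerm-cong (param a)  eq = cong param (eq a param)
    renTerm-cong (fun f ts) eq = cong (fun f) (renTerms-cong ts λ a → eq a ∘ fun)

    renTerms-cong []       eq = refl
    renTerms-cong (t ∷ ts) eq =
      cong₂ _∷_ (renTerm-cong t λ a → eq a ∘ here) (renTerms-cong ts λ a → eq a ∘ there)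

    renRPL-cong : ∀ A → (∀ a → ParamInRPL∀ a A → τ a ≡ τ′ a) →
                  renRPL τ A ≡ renRPL τ′ A
    renRPL-cong (pred P ts)   eq = cong (pred P) (renTerms-cong ts eq)
    renRPL-cong (const r)     eq = refl
    renRPL-cong (A ⊃ B)       eq =
      cong₂ _⊃_ (renRPL-cong A λ a → eq a ∘ inj₁) (renRPL-cong B λ a → eq a ∘ inj₂)
    renRPL-cong (forall′ x A) eq = cong (forall′ x) (renRPL-cong A eq)
    renRPL-cong (exists′ x A) eq = cong (exists′ x) (renRPL-cong A eq)

  Occurs : Kind → ℕ → Formula 𝒮 → Set
  Occurs paramᵏ e F = ParamIn e F
  Occurs type1ᵏ e F = sp (type1 e) ≡ F
  Occurs type0ᵏ e F = sp (type0 e) ≡ F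

-- Bounds on occurring symbols, and renaming of formulas

Bounded : (ℕ → Set) → Set
Bounded P = ∃[ N ] (∀ e → P e → e ℕ.< N)

Bounded-⊎ : ∀ {P Q} → Bounded P → Bounded Q → Bounded λ e → P e ⊎ Q e
Bounded-⊎ (M , p) (N , q) = M ⊔ N , λ where
  e (inj₁ x) → ℕ.<-≤-trans (p e x) (ℕ.m≤m⊔n M N)
  e (inj₂ y) → ℕ.<-≤-trans (q e y) (ℕ.m≤n⊔m M N)

Bounded-map : ∀ {P Q : ℕ → Set} → (∀ {e} → Q e → P e) → Bounded P → Bounded Q
Bounded-map f (N , p) = N , λ e → p e ∘ f

Bounded-Any : ∀ {A : Set} {P : ℕ → A → Set} → (∀ x → Bounded λ e → P e x) →
              ∀ xs → Bounded λ e → Any (P e) xs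
Bounded-Any b []       = 0 , λ _ ()
Bounded-Any b (x ∷ xs) =
  Bounded-map (λ { (here p) → inj₁ p ; (there p) → inj₂ p })
    (Bounded-⊎ (b x) (Bounded-Any b xs))

Bounded-VecAny : ∀ {A : Set} {P : ℕ → A → Set} → (∀ x → Bounded λ e → P e x) →
                 ∀ {n} (xs : Vec A n) → Bounded λ e → VecAny.Any (P e) xs
Bounded-VecAny b []       = 0 , λ _ ()
Bounded-VecAny b (x ∷ xs) =
  Bounded-map (λ { (here p) → inj₁ p ; (there p) → inj₂ p })
    (Bounded-⊎ (b x) (Bounded-VecAny b xs))

module _ {𝒮 : Signature} where

  ParamInTerm-bounded : (t : Term 𝒮) → Bounded λ a → ParamInTerm a t
  ParamInTerms-bounded : ∀ {n} (ts : Vec (Term 𝒮) n) →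
                         Bounded λ a → VecAny.Any (ParamInTerm a) ts

  ParamInTerm-bounded (var x)    = 0 , λ _ ()
  ParamInTerm-bounded (param b)  = suc b , λ { _ param → ℕ.n<1+n b }
  ParamInTerm-bounded (fun f ts) =
    Bounded-map (λ { (fun p) → p }) (ParamInTerms-bounded ts)

  ParamInTerms-bounded []       = 0 , λ _ ()
  ParamInTerms-bounded (t ∷ ts) =
    Bounded-map (λ { (here p) → inj₁ p ; (there p) → inj₂ p })
      (Bounded-⊎ (ParamInTerm-bounded t) (ParamInTerms-bounded ts))

  ParamInRPL∀-bounded : (A : RPL∀ 𝒮) → Bounded λ a → ParamInRPL∀ a A
  ParamInRPL∀-bounded (pred P ts)   = ParamInTerms-bounded ts
  ParamInRPL∀-bounded (const r)     = 0 , λ _ ()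
  ParamInRPL∀-bounded (A ⊃ B)       =
    Bounded-⊎ (ParamInRPL∀-bounded A) (ParamInRPL∀-bounded B)
  ParamInRPL∀-bounded (forall′ x A) = ParamInRPL∀-bounded A
  ParamInRPL∀-bounded (exists′ x A) = ParamInRPL∀-bounded A

  Occurs-bounded : ∀ k (F : Formula 𝒮) → Bounded λ e → Occurs k e F
  Occurs-bounded paramᵏ (rpl A)        = ParamInRPL∀-bounded A
  Occurs-bounded paramᵏ (sp v)         = 0 , λ _ ()
  Occurs-bounded type1ᵏ (rpl A)        = 0 , λ _ ()
  Occurs-bounded type1ᵏ (sp (type1 p)) = suc p , λ { _ refl → ℕ.n<1+n p }
  Occurs-bounded type1ᵏ (sp (type0 q)) = 0 , λ _ ()
  Occurs-bounded type0ᵏ (rpl A)        = 0 , λ _ ()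
  Occurs-bounded type0ᵏ (sp (type1 p)) = 0 , λ _ ()
  Occurs-bounded type0ᵏ (sp (type0 q)) = suc q , λ { _ refl → ℕ.n<1+n q }

  renFormula : Renaming → Formula 𝒮 → Formula 𝒮
  renFormula ρ (rpl A) = rpl (renRPL (ρ paramᵏ) A)
  renFormula ρ (sp v)  = sp (renSP ρ v)

  renFormula-id : ∀ F → renFormula idʳ F ≡ F
  renFormula-id (rpl A)        = cong rpl (renRPL-id A)
  renFormula-id (sp (type1 p)) = refl
  renFormula-id (sp (type0 q)) = refl

  renFormula-cong : ∀ {ρ ρ′} F → (∀ k e → Occurs k e F → ρ k e ≡ ρ′ k e) →
                    renFormula ρ F ≡ renFormula ρ′ F
  renFormula-cong (rpl A)        eq = cong rpl (renRPL-cong A (eq paramᵏ))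
  renFormula-cong (sp (type1 p)) eq = cong (λ e → Formula.sp (type1 e)) (eq type1ᵏ p refl)
  renFormula-cong (sp (type0 q)) eq = cong (λ e → Formula.sp (type0 e)) (eq type0ᵏ q refl)

  -- This is what lets an eigenvariable be redirected: the formulas of the conclusion do not contain
  -- it, so their renamings stay put.
  renFormula-update : ∀ ρ k e e′ F → ¬ Occurs k e F →
                      renFormula ρ F ≡ renFormula (ρ [ k , e ↦ e′ ]) F
  renFormula-update ρ k e e′ F e∉F = renFormula-cong F λ k₁ e₁ occ →
    sym (update-other ρ k e e′ λ { (refl , refl) → e∉F occ })

  renFormula-IsAtom : ∀ ρ {F} → IsAtom F → IsAtom (renFormula ρ F)
  renFormula-IsAtom ρ (pred P ts) = pred P _
  renFormula-IsAtom ρ (const r)   = const r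
  renFormula-IsAtom ρ (sp v)      = sp _

-- Permutations of lists over a setoid

module _ {a ℓ} (X : Setoid a ℓ) where
  private
    module X = Setoid X
    module P = PermutationSetoid X
    module P′ = PermutationSetoidProperties X

  Any-extract : ∀ {p} {P : X.Carrier → Set p} {xs} → Any P xs →
                ∃[ x ] ∃[ ys ] P x × xs P.↭ x ∷ ys
  Any-extract {xs = x ∷ xs} (here px)    = x , xs , px , P.↭-refl
  Any-extract {xs = x ∷ xs} (there x∈xs) =
    let y , ys , py , perm = Any-extract x∈xs in
    y , x ∷ ys , py , P.↭-trans (P.↭-prep x perm) (P.↭-swap x y P.↭-refl)

  -- Locate `y` in `x ∷ xs`. At the head it matches `x`; in the tail it can be extracted, and
  -- cancelling it on both sides exhibits `x` among `ys`.
  ∷-↭-inv : ∀ {x y xs ys} → x ∷ xs P.↭ y ∷ ys →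
            (x X.≈ y × xs P.↭ ys) ⊎ (∃[ zs ] xs P.↭ y ∷ zs × ys P.↭ x ∷ zs)
  ∷-↭-inv {x} {y} {xs} {ys} perm with P′.∈-resp-↭ (P.↭-sym perm) (here X.refl)
  ... | here y≈x = inj₁ (X.sym y≈x ,
          P′.drop-∷ (P.↭-trans perm (P.prep y≈x P.↭-refl)))
  ... | there y∈xs =
    let z , zs , y≈z , xs↭ = Any-extract y∈xs
        xs↭′ = P.↭-trans xs↭ (P.prep (X.sym y≈z) P.↭-refl)
    in inj₂ (zs , xs↭′ , P′.drop-∷ (P.↭-trans (P.↭-sym perm)
         (P.↭-trans (P.↭-prep x xs↭′) (P.↭-swap x y P.↭-refl))))

-- Nonnegative reals

0≤ᴿ-resp : ∀ x y → (∀ n → seq x n ≡ seq y n) → 0ᴿ ≤ᴿ x → 0ᴿ ≤ᴿ y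
0≤ᴿ-resp x y eq p ε 0<ε = let N , q = p ε 0<ε in
  N , λ n N≤n → subst (λ z → 0ℚ ℚ.≤ z ℚ.+ ε) (eq n) (q n N≤n)

Negative : ℝ → Set
Negative x = ∃[ ε ] 0ℚ ℚ.< ε × ∃[ N ] (∀ n → N ℕ.≤ n → seq x n ℚ.≤ ℚ.- ε)

p≤∣p∣ : ∀ p → p ℚ.≤ ℚ.∣ p ∣
p≤∣p∣ p with ℚ.≤-total 0ℚ p
... | inj₁ 0≤p = ℚ.≤-reflexive (sym (ℚ.0≤p⇒∣p∣≡p 0≤p))
... | inj₂ p≤0 = ℚ.≤-trans p≤0 (ℚ.0≤∣p∣ p)

-- The sign of x is decided up to ε by a single far enough term of its sequence.
¬Negative⇒0≤ᴿ : ∀ x → ¬ Negative x → 0ᴿ ≤ᴿ x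
¬Negative⇒0≤ᴿ x ¬neg ε 0<ε with cauchy x (½ ℚ.* ε) 0<½ε
  where
  0<½ε = subst (ℚ._< ½ ℚ.* ε) (ℚ.*-zeroʳ ½) (ℚ.*-monoʳ-<-pos ½ 0<ε)
... | N , close with ℚ.- (½ ℚ.* ε) ℚ.≤? seq x N
-- One half of `ε` covers the deficit of the `N`th term, the other half its distance from the later
-- terms.
...   | yes -δ≤xN = N , λ n N≤n → begin
        0ℚ                                      ≡⟨ sym (ℚ.+-inverseˡ δ) ⟩
        ℚ.- δ ℚ.+ δ                             ≤⟨ ℚ.+-monoˡ-≤ δ -δ≤xN ⟩
        seq x N ℚ.+ δ                           ≡⟨ regroup (seq x N) (seq x n) δ ⟩
        (seq x N ℚ.- seq x n) ℚ.+ (seq x n ℚ.+ δ)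
          ≤⟨ ℚ.+-monoˡ-≤ (seq x n ℚ.+ δ) (≤-close N n ℕ.≤-refl N≤n) ⟩
        δ ℚ.+ (seq x n ℚ.+ δ)                   ≡⟨ double (seq x n) ε ⟩
        seq x n ℚ.+ ε                           ∎
  where
  open ℚ.≤-Reasoning
  δ = ½ ℚ.* ε
  ≤-close : ∀ m n → N ℕ.≤ m → N ℕ.≤ n → seq x m ℚ.- seq x n ℚ.≤ δ
  ≤-close m n l l′ = ℚ.≤-trans (p≤∣p∣ _) (ℚ.<⇒≤ (close m n l l′))
  regroup : ∀ a b c → a ℚ.+ c ≡ (a ℚ.- b) ℚ.+ (b ℚ.+ c)
  regroup = solve 3 (λ a b c → a :+ c := (a :- b) :+ (b :+ c)) refl
  double : ∀ a b → ½ ℚ.* b ℚ.+ (a ℚ.+ ½ ℚ.* b) ≡ a ℚ.+ b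
  double = solve 2 (λ a b → con ½ :* b :+ (a :+ con ½ :* b) := a :+ b) refl
-- Here the `N`th term is below `-δ` and later terms exceed it by at most `δ`, so `-(seq x N + δ)`
-- is a positive gap below zero.
...   | no -δ≰xN = contradiction
  (ℚ.- (seq x N ℚ.+ δ) , 0<η , N , λ n N≤n → begin
    seq x n                              ≡⟨ regroup (seq x n) (seq x N) ⟩
    (seq x n ℚ.- seq x N) ℚ.+ seq x N
      ≤⟨ ℚ.+-monoˡ-≤ (seq x N) (ℚ.≤-trans (p≤∣p∣ _) (ℚ.<⇒≤ (close n N N≤n ℕ.≤-refl))) ⟩
    δ ℚ.+ seq x N                        ≡⟨ twice (seq x N) δ ⟩
    ℚ.- (ℚ.- (seq x N ℚ.+ δ))            ∎) ¬neg
  where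
  open ℚ.≤-Reasoning
  δ = ½ ℚ.* ε
  regroup : ∀ a b → a ≡ (a ℚ.- b) ℚ.+ b
  regroup = solve 2 (λ a b → a := (a :- b) :+ b) refl
  twice : ∀ a b → b ℚ.+ a ≡ ℚ.- (ℚ.- (a ℚ.+ b))
  twice = solve 2 (λ a b → b :+ a := :- (:- (a :+ b))) refl
  0<η : 0ℚ ℚ.< ℚ.- (seq x N ℚ.+ δ)
  0<η = ℚ.neg-antimono-< (subst (seq x N ℚ.+ δ ℚ.<_) (ℚ.+-inverseˡ δ)
          (ℚ.+-monoˡ-< δ (ℚ.≰⇒> -δ≰xN)))

-- If `x` is negative, then `y` is eventually at least `z` and inherits its nonnegativity. The
-- double negation stands for the undecidable choice between the summands.
0≤ᴿ-split : ∀ x y z → (∀ n → seq z n ≡ seq x n ℚ.+ seq y n) → 0ᴿ ≤ᴿ z →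
            ¬ ¬ (0ᴿ ≤ᴿ x ⊎ 0ᴿ ≤ᴿ y)
0≤ᴿ-split x y z z≡x+y 0≤z neither =
  neither (inj₁ (¬Negative⇒0≤ᴿ x (neither ∘ inj₂ ∘ 0≤y)))
  where
  open ℚ.≤-Reasoning
  0≤y : Negative x → 0ᴿ ≤ᴿ y
  0≤y (ε , 0<ε , M , x≤-ε) ε′ 0<ε′ = let N , p = 0≤z ε′ 0<ε′ in
    M ⊔ N , λ n l → begin
      0ℚ                              ≤⟨ p n (ℕ.≤-trans (ℕ.m≤n⊔m M N) l) ⟩
      seq z n ℚ.+ ε′                  ≡⟨ cong (ℚ._+ ε′) (z≡x+y n) ⟩
      (seq x n ℚ.+ seq y n) ℚ.+ ε′    ≡⟨ ℚ.+-assoc (seq x n) (seq y n) ε′ ⟩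
      seq x n ℚ.+ (seq y n ℚ.+ ε′)
        ≤⟨ ℚ.+-monoˡ-≤ (seq y n ℚ.+ ε′) (ℚ.≤-trans
             (x≤-ε n (ℕ.≤-trans (ℕ.m≤m⊔n M N) l)) (ℚ.neg-antimono-≤ (ℚ.<⇒≤ 0<ε))) ⟩
      0ℚ ℚ.+ (seq y n ℚ.+ ε′)         ≡⟨ ℚ.+-identityˡ _ ⟩
      seq y n ℚ.+ ε′                  ∎

-- Sequents as multisets of signed formulas

data Side : Set where
  left right : Side

module Signed (𝒮 : Signature) where

  -- With both sides of a sequent merged into one multiset, left and right rules get a common
  -- treatment and the truth of a sequent depends on a single sum.
  SignedFormula : Set
  SignedFormula = Side × Formula 𝒮

  pattern L F = left , F
  pattern R F = right , F

  unsign : SignedFormula → Formula 𝒮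
  unsign = proj₂

  Seq HSeq : Set
  Seq  = List SignedFormula
  HSeq = List Seq

  seqSetoid : Setoid _ _
  seqSetoid = ↭.↭-setoid {A = SignedFormula}

  module ~ where
    open PermutationSetoid seqSetoid public
    open PermutationSetoidProperties seqSetoid public
  open PermutationSetoid seqSetoid using () renaming (_↭_ to _~_)

  ren : Renaming → SignedFormula → SignedFormula
  ren ρ (s , F) = s , renFormula ρ F

  renSeq : Renaming → Seq → Seq
  renSeq ρ = map (ren ρ)

  renH : Renaming → HSeq → HSeq
  renH ρ = map (renSeq ρ)

  OccursS : Kind → ℕ → SignedFormula → Set
  OccursS k e F = Occurs k e (unsign F)

  Fresh : Kind → ℕ → HSeq → Set
  Fresh k e H = ¬ Any (Any (OccursS k e)) H

  -- A strict bound on the occurring indices is itself an index that does not occur.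
  fresh : ∀ k H → ∃[ e ] Fresh k e H
  fresh k H =
    let N , below = Bounded-Any (Bounded-Any (Occurs-bounded k ∘ unsign)) H
    in N , λ occ → ℕ.<-irrefl refl (below N occ)

  Fresh-resp : ∀ k e {H H′} → H ~ H′ → Fresh k e H → Fresh k e H′
  Fresh-resp k e p fr = fr ∘ ~.Any-resp-↭ ↭.Any-resp-↭ (~.↭-sym p)

  Fresh-uncons : ∀ k e {F S G} → Fresh k e ((F ∷ S) ∷ G) →
                 ¬ OccursS k e F × ¬ Any (OccursS k e) S × Fresh k e G
  Fresh-uncons k e fr =
    (λ occ → fr (here (here occ))) , (λ occ → fr (here (there occ))) , (λ occ → fr (there occ))

  ren-id : ∀ F → ren idʳ F ≡ F
  ren-id (s , F) = cong (s ,_) (renFormula-id F)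

  renSeq-id : ∀ S → renSeq idʳ S ≡ S
  renSeq-id S = trans (List.map-cong ren-id S) (List.map-id S)

  renH-id : ∀ H → renH idʳ H ≡ H
  renH-id H = trans (List.map-cong renSeq-id H) (List.map-id H)

  renH-resp : ∀ ρ {H H′} → H ~ H′ → renH ρ H ~ renH ρ H′
  renH-resp ρ = ~.map⁺ seqSetoid (↭.map⁺ (ren ρ))

  -- Comparing renamings only on the formulas at hand makes redirecting an eigenvariable invisible
  -- to sequents that do not contain it.
  Agree : Renaming → Renaming → Seq → Set
  Agree ρ ρ′ = All λ F → ren ρ F ≡ ren ρ′ F

  renSeq-agree : ∀ {ρ ρ′ S} → Agree ρ ρ′ S → renSeq ρ S ≡ renSeq ρ′ S
  renSeq-agree []         = refl
  renSeq-agree (eq ∷ eqs) = cong₂ _∷_ eq (renSeq-agree eqs)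

  renH-agree : ∀ {ρ ρ′ H} → All (Agree ρ ρ′) H → renH ρ H ≡ renH ρ′ H
  renH-agree []         = refl
  renH-agree (eq ∷ eqs) = cong₂ _∷_ (renSeq-agree eq) (renH-agree eqs)

  ren-update : ∀ ρ k e e′ F → ¬ OccursS k e F → ren ρ F ≡ ren (ρ [ k , e ↦ e′ ]) F
  ren-update ρ k e e′ (s , F) e∉F = cong (s ,_) (renFormula-update ρ k e e′ F e∉F)

  Agree-update : ∀ ρ k e e′ S → ¬ Any (OccursS k e) S → Agree ρ (ρ [ k , e ↦ e′ ]) S
  Agree-update ρ k e e′ S e∉S = All.map (ren-update ρ k e e′ _) (All.¬Any⇒All¬ S e∉S)

  AgreeH-update : ∀ ρ k e e′ H → Fresh k e H → All (Agree ρ (ρ [ k , e ↦ e′ ])) H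
  AgreeH-update ρ k e e′ H e∉H = All.map (Agree-update ρ k e e′ _) (All.¬Any⇒All¬ H e∉H)

  -- Rules as reductions of a principal formula

  -- A premise is obtained from the conclusion by replacing the principal
  -- formula with the first component and adding the sequents in the second.
  Change : Set
  Change = Seq × HSeq

  premise : Change → Seq → HSeq → HSeq
  premise (Φ , E) S G = (Φ ++ S) ∷ E ++ G

  renChange : Renaming → Change → Change
  renChange ρ (Φ , E) = renSeq ρ Φ , renH ρ E

  -- Reduction r k e F cs: rule r with principal formula F and with eigenvariable
  -- or eigenparameter e of kind k.  For ⇒→, which has none, e is a dummy.
  data Reduction : (r : G³Ł∀Rule) → Kind → ℕ → SignedFormula →
                   Vec Change (G³Ł∀-arity r) → Set where
    →⇒ : ∀ {A B} p → Reduction →⇒ type1ᵏ p (L (rpl (A ⊃ B)))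
      ((L (sp (type1 p)) ∷ [] ,
        (L (rpl B) ∷ R (sp (type1 p)) ∷ R (rpl A) ∷ []) ∷ []) ∷ [])
    ⇒→ : ∀ {A B} a → Reduction ⇒→ paramᵏ a (R (rpl (A ⊃ B)))
      (([] , []) ∷ (L (rpl A) ∷ R (rpl B) ∷ [] , []) ∷ [])
    ∀⇒ : ∀ {x A t} p → Closed t → Reduction ∀⇒ type1ᵏ p (L (rpl (forall′ x A)))
      ((L (sp (type1 p)) ∷ [] ,
        (L (rpl (forall′ x A)) ∷ R (sp (type1 p)) ∷ []) ∷
        (L (rpl (A [ x ≔ t ])) ∷ R (sp (type1 p)) ∷ []) ∷ []) ∷ [])
    ⇒∀ : ∀ {x A} a → Reduction ⇒∀ paramᵏ a (R (rpl (forall′ x A)))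
      ((R (rpl (A [ x ≔ param a ])) ∷ [] , []) ∷ [])
    ⇒∃ : ∀ {x A t} q → Closed t → Reduction ⇒∃ type0ᵏ q (R (rpl (exists′ x A)))
      ((R (sp (type0 q)) ∷ [] ,
        (L (sp (type0 q)) ∷ R (rpl (exists′ x A)) ∷ []) ∷
        (L (sp (type0 q)) ∷ R (rpl (A [ x ≔ t ])) ∷ []) ∷ []) ∷ [])
    ∃⇒ : ∀ {x A} a → Reduction ∃⇒ paramᵏ a (L (rpl (exists′ x A)))
      ((L (rpl (A [ x ≔ param a ])) ∷ [] , []) ∷ [])

  -- The rules are schematic: renaming commutes with substitution and keeps closed terms closed.
  Reduction-ren : ∀ ρ {r k e F cs} → Reduction r k e F cs →
                  Reduction r k (ρ k e) (ren ρ F) (Vec.map (renChange ρ) cs)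
  Reduction-ren ρ (→⇒ p) = →⇒ (ρ type1ᵏ p)
  Reduction-ren ρ (⇒→ a) = ⇒→ (ρ paramᵏ a)
  Reduction-ren ρ (∀⇒ {x} {A} {t} p cl) rewrite renRPL-subst (ρ paramᵏ) A x t =
    ∀⇒ (ρ type1ᵏ p) (Closed-renTerm (ρ paramᵏ) cl)
  Reduction-ren ρ (⇒∀ {x} {A} a) rewrite renRPL-subst (ρ paramᵏ) A x (param a) =
    ⇒∀ (ρ paramᵏ a)
  Reduction-ren ρ (⇒∃ {x} {A} {t} q cl) rewrite renRPL-subst (ρ paramᵏ) A x t =
    ⇒∃ (ρ type0ᵏ q) (Closed-renTerm (ρ paramᵏ) cl)
  Reduction-ren ρ (∃⇒ {x} {A} a) rewrite renRPL-subst (ρ paramᵏ) A x (param a) =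
    ∃⇒ (ρ paramᵏ a)

  -- Rules whose premises do not depend on the choice of a closed term.
  Deterministic : G³Ł∀Rule → Set
  Deterministic ∀⇒ = ⊥
  Deterministic ⇒∃ = ⊥
  Deterministic _  = ⊤

  -- In these rules the principal formula leaves only the eigenvariable of the premises open, and
  -- `ρ k e ≡ e′` aligns the two choices of it.
  Reduction-deterministic : ∀ ρ {r k e F cs r′ k′ e′ cs′} →
    Reduction r k e F cs → Deterministic r′ → Reduction r′ k′ e′ (ren ρ F) cs′ →
    ρ k e ≡ e′ → ∀ i → ∃[ j ] lookup cs′ i ≡ renChange ρ (lookup cs j)
  Reduction-deterministic ρ (→⇒ p) _ (→⇒ _) refl zero       = zero , refl
  Reduction-deterministic ρ (⇒→ a) _ (⇒→ _) _ zero          = zero , refl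
  Reduction-deterministic ρ (⇒→ a) _ (⇒→ _) _ (suc zero)    = suc zero , refl
  Reduction-deterministic ρ (∀⇒ _ _) () (∀⇒ _ _)
  Reduction-deterministic ρ (⇒∃ _ _) () (⇒∃ _ _)
  Reduction-deterministic ρ (⇒∀ {x} {A} a) _ (⇒∀ _) refl zero =
    zero , cong (λ B → R (rpl B) ∷ [] , []) (sym (renRPL-subst (ρ paramᵏ) A x (param a)))
  Reduction-deterministic ρ (∃⇒ {x} {A} a) _ (∃⇒ _) refl zero =
    zero , cong (λ B → L (rpl B) ∷ [] , []) (sym (renRPL-subst (ρ paramᵏ) A x (param a)))

  -- Allows an inference to be repeated with a new eigenvariable `e′`: as `e` is absent from `F`,
  -- sending it to `e′` is felt only in the premises.
  Reduction-update : ∀ ρ {r k e F cs} → Reduction r k e F cs → ¬ OccursS k e F → ∀ e′ →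
    Reduction r k e′ (ren ρ F) (Vec.map (renChange (ρ [ k , e ↦ e′ ])) cs)
  Reduction-update ρ {k = k} {e} {F} red e∉F e′ =
    subst₂ (λ e₁ F₁ → Reduction _ k e₁ F₁ (Vec.map (renChange (ρ [ k , e ↦ e′ ])) _))
      (update-same ρ k e e′) (sym (ren-update ρ k e e′ F e∉F))
      (Reduction-ren (ρ [ k , e ↦ e′ ]) red)

  Reduction-nonatomic : ∀ {r k e F cs} → Reduction r k e F cs → ¬ IsAtom (unsign F)
  Reduction-nonatomic (→⇒ _)   ()
  Reduction-nonatomic (⇒→ _)   ()
  Reduction-nonatomic (∀⇒ _ _) ()
  Reduction-nonatomic (⇒∀ _)   ()
  Reduction-nonatomic (⇒∃ _ _) ()
  Reduction-nonatomic (∃⇒ _)   ()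

  -- Transformations of a single sequent

  -- The new symbols, `v` in `split` and the eigenvariable in `invert`, are named as they appear in
  -- the result. They therefore stay fixed while `ρ` varies in the induction.
  data Step (ρ : Renaming) (S : Seq) : HSeq → Set where
    rename : Step ρ S (renSeq ρ S ∷ [])
    split  : ∀ {S₁ S₂} v → S ↭ S₁ ++ S₂ →
             Step ρ S ((R (sp v) ∷ renSeq ρ S₁) ∷ (L (sp v) ∷ renSeq ρ S₂) ∷ [])
    invert : ∀ {F S′ r k e cs} i → Deterministic r → S ↭ F ∷ S′ →
             Reduction r k e (ren ρ F) cs →
             Step ρ S (premise (lookup cs i) (renSeq ρ S′) [])

  Step-agree : ∀ {ρ ρ′ S Ss} → Agree ρ ρ′ S → Step ρ S Ss → Step ρ′ S Ss
  Step-agree {ρ′ = ρ′} {S} ag rename =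
    subst (λ S′ → Step ρ′ S (S′ ∷ [])) (sym (renSeq-agree ag)) rename
  Step-agree {ρ′ = ρ′} {S} ag (split {S₁} {S₂} v p) =
    let ag₁ , ag₂ = All.++⁻ S₁ (↭.All-resp-↭ p ag) in
    subst₂ (λ S₁ S₂ → Step ρ′ S ((R (sp v) ∷ S₁) ∷ (L (sp v) ∷ S₂) ∷ []))
      (sym (renSeq-agree ag₁)) (sym (renSeq-agree ag₂)) (split v p)
  Step-agree {ρ′ = ρ′} {S} ag (invert {cs = cs} i det p red) with ↭.All-resp-↭ p ag
  ... | agF ∷ agS =
    subst (λ S′ → Step ρ′ S (premise (lookup cs i) S′ [])) (sym (renSeq-agree agS))
      (invert i det p (subst (λ F → Reduction _ _ _ F cs) agF red))

  -- One sequent undergoes a step, the others are renamed by ρ, and X is added.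
  record Transforms (ρ : Renaming) (H H′ : HSeq) : Set where
    constructor transforms
    field
      {S}     : Seq
      {G Ss}  : HSeq
      X       : HSeq
      source  : H ~ S ∷ G
      step    : Step ρ S Ss
      target  : H′ ~ Ss ++ (renH ρ G ++ X)

  -- A step on a sequent F ∷ S either leaves F in place, to be reduced afterwards (Pass),
  -- or inverts the very occurrence of F (Hit).
  record Pass (ρ : Renaming) (F : SignedFormula) (S : Seq) (Ss : HSeq) : Set where
    constructor pass
    field
      {rest}    : Seq
      {others}  : HSeq
      focus     : Ss ~ (ren ρ F ∷ rest) ∷ others
      continue  : ∀ ρ′ Φ → Agree ρ ρ′ S →
                  ∃[ Ss′ ] Step ρ′ (Φ ++ S) Ss′ × Ss′ ~ (renSeq ρ′ Φ ++ rest) ∷ others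

  record Hit (ρ : Renaming) (F : SignedFormula) (S : Seq) (Ss : HSeq) : Set where
    constructor hit
    field
      {r}     : G³Ł∀Rule
      {k}     : Kind
      {e}     : ℕ
      {cs}    : Vec Change (G³Ł∀-arity r)
      i       : Fin (G³Ł∀-arity r)
      det     : Deterministic r
      red     : Reduction r k e (ren ρ F) cs
      focus   : Ss ~ premise (lookup cs i) (renSeq ρ S) []

  ∷-↭-invS : ∀ {F F′ S S′} → F ∷ S ↭ F′ ∷ S′ →
             (F ≡ F′ × S ↭ S′) ⊎ (∃[ S″ ] S ↭ F′ ∷ S″ × S′ ↭ F ∷ S″)
  ∷-↭-invS p with ∷-↭-inv (≡.setoid SignedFormula) (↭⇒↭ₛ p)
  ... | inj₁ (eq , q)     = inj₁ (eq , ↭ₛ⇒↭ q)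
  ... | inj₂ (S″ , q , r) = inj₂ (S″ , ↭ₛ⇒↭ q , ↭ₛ⇒↭ r)

  ∷-↭-++-inv : ∀ {F S} S₁ {S₂} → F ∷ S ↭ S₁ ++ S₂ →
               (∃[ S₁′ ] S₁ ↭ F ∷ S₁′ × S ↭ S₁′ ++ S₂) ⊎
               (∃[ S₂′ ] S₂ ↭ F ∷ S₂′ × S ↭ S₁ ++ S₂′)
  ∷-↭-++-inv {F} S₁ {S₂} p with Any.++⁻ S₁ (↭.∈-resp-↭ p (here refl))
  ... | inj₁ F∈ with Any-extract (≡.setoid SignedFormula) F∈
  ... | _ , S₁′ , refl , q = inj₁ (S₁′ , ↭ₛ⇒↭ q ,
          ↭.drop-∷ (↭-trans p (↭.++⁺ʳ S₂ (↭ₛ⇒↭ q))))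
  ∷-↭-++-inv {F} S₁ {S₂} p | inj₂ F∈ with Any-extract (≡.setoid SignedFormula) F∈
  ... | _ , S₂′ , refl , q = inj₂ (S₂′ , ↭ₛ⇒↭ q ,
          ↭.drop-∷ (↭-trans p (↭-trans (↭.++⁺ˡ S₁ (↭ₛ⇒↭ q)) (↭.shift F S₁ S₂′))))

  renSeq-++-agree : ∀ {ρ} ρ′ Φ {S} → Agree ρ ρ′ S →
                    renSeq ρ′ (Φ ++ S) ≡ renSeq ρ′ Φ ++ renSeq ρ S
  renSeq-++-agree ρ′ Φ {S} ag =
    trans (List.map-++ (ren ρ′) Φ S) (cong (renSeq ρ′ Φ ++_) (sym (renSeq-agree ag)))

  renH-++-agree : ∀ {ρ} ρ′ E {G} → All (Agree ρ ρ′) G →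
                  renH ρ′ (E ++ G) ≡ renH ρ′ E ++ renH ρ G
  renH-++-agree ρ′ E {G} ag =
    trans (List.map-++ (renSeq ρ′) E G) (cong (renH ρ′ E ++_) (sym (renH-agree ag)))

  ∷-renSeq-++ : ∀ {ρ} ρ′ Φ S → Agree ρ ρ′ S → ∀ x →
                x ∷ renSeq ρ′ (Φ ++ S) ↭ renSeq ρ′ Φ ++ x ∷ renSeq ρ S
  ∷-renSeq-++ ρ′ Φ S ag x = ↭-trans
    (↭.↭-reflexive (cong (x ∷_) (renSeq-++-agree ρ′ Φ ag)))
    (↭-sym (↭.shift x (renSeq ρ′ Φ) _))

  -- After a split, `F` lies in one of the two halves, and the formulas `Φ` that replace it in a
  -- premise can be sent to the same half. An inversion of another occurrence keeps `F` among the
  -- side formulas, so only an inversion of this very occurrence fails to pass.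
  progress : ∀ {ρ F S S₀ Ss} → S ↭ F ∷ S₀ → Step ρ S Ss →
             Pass ρ F S₀ Ss ⊎ Hit ρ F S₀ Ss
  progress {ρ} {S₀ = S₀} p rename = inj₁ (pass (~.prep (↭.map⁺ _ p) ~.↭-refl)
    λ ρ′ Φ ag → _ , rename , ~.↭-reflexive (cong (_∷ []) (renSeq-++-agree ρ′ Φ ag)))
  progress {ρ} {F} p (split {S₁} {S₂} v q) with ∷-↭-++-inv S₁ (↭-trans (↭-sym p) q)
  ... | inj₁ (S₁′ , S₁↭ , S₀↭) = inj₁ (pass
    (~.prep (↭-trans (↭-prep _ (↭.map⁺ _ S₁↭)) (↭-swap _ _ ↭.refl)) ~.↭-refl)
    λ ρ′ Φ ag → let ag₁ , ag₂ = All.++⁻ S₁′ (↭.All-resp-↭ S₀↭ ag) in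
      _ , split v (↭-trans (↭.++⁺ˡ Φ S₀↭) (↭-sym (↭.++-assoc Φ S₁′ S₂))) ,
      ~.prep (∷-renSeq-++ ρ′ Φ S₁′ ag₁ (R (sp v)))
        (~.prep (↭.↭-reflexive (cong (_ ∷_) (sym (renSeq-agree ag₂)))) ~.↭-refl))
  ... | inj₂ (S₂′ , S₂↭ , S₀↭) = inj₁ (pass
    (~.↭-trans (~.↭-swap _ _ ~.↭-refl)
      (~.prep (↭-trans (↭-prep _ (↭.map⁺ _ S₂↭)) (↭-swap _ _ ↭.refl)) ~.↭-refl))
    λ ρ′ Φ ag → let ag₁ , ag₂ = All.++⁻ S₁ (↭.All-resp-↭ S₀↭ ag) in
      _ , split v (↭-trans (↭.++⁺ˡ Φ S₀↭) (↭.shifts Φ S₁)) ,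
      ~.swap (↭.↭-reflexive (cong (_ ∷_) (sym (renSeq-agree ag₁))))
        (∷-renSeq-++ ρ′ Φ S₂′ ag₂ (L (sp v))) ~.↭-refl)
  progress {ρ} {F} p (invert {cs = cs} i det q red) with ∷-↭-invS (↭-trans (↭-sym p) q)
  ... | inj₁ (refl , S₀↭) =
    inj₂ (hit i det red (~.prep (↭.++⁺ˡ (proj₁ (lookup cs i)) (↭.map⁺ _ (↭-sym S₀↭))) ~.↭-refl))
  ... | inj₂ (S₁ , S₀↭ , S′↭) = inj₁ (pass
    (~.prep (↭-trans (↭.++⁺ˡ Ψ (↭.map⁺ _ S′↭)) (↭.shift _ Ψ _)) ~.↭-refl)
    cont)
    where
    Ψ = proj₁ (lookup cs i)
    cont : ∀ ρ′ Φ → _ → _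
    cont ρ′ Φ ag with ↭.All-resp-↭ S₀↭ ag
    ... | agF ∷ ag₁ = _ ,
      invert i det (↭-trans (↭.++⁺ˡ Φ S₀↭) (↭.shift _ Φ S₁))
        (subst (λ F → Reduction _ _ _ F cs) agF red) ,
      ~.prep (↭-trans
        (↭.↭-reflexive (cong (Ψ ++_) (renSeq-++-agree ρ′ Φ ag₁)))
        (↭.shifts Ψ (renSeq ρ′ Φ))) ~.↭-refl

  -- Semantics of signed sequents

  sign : Sequent 𝒮 → Seq
  sign (Γ , Δ) = map L Γ ++ map R Δ

  module _ (M : HsInterpretation 𝒮) (ν : Valuation M) where
    open HsInterpretation M

    -- Compound formulas get the junk value 0.
    formulaValue : Formula 𝒮 → ℝ
    formulaValue (rpl (pred P ts)) = ⟦pred⟧ P (⟦_⟧ᵗˢ M ν ts)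
    formulaValue (rpl (const r))   = fromℚ (Rational01.value r)
    formulaValue (rpl _)           = 0ᴿ
    formulaValue (sp v)            = ⟦sp⟧ v

    -- The antecedent enters with a minus sign, so that truth of an atomic sequent becomes
    -- nonnegativity of the total.
    contribution : SignedFormula → ℝ
    contribution (L F) = -ᴿ (formulaValue F -ᴿ 1ᴿ)
    contribution (R F) = formulaValue F -ᴿ 1ᴿ

    value : Seq → ℝ
    value S = sumᴿ (map contribution S)

    True : Seq → Set
    True S = All (IsAtom ∘ unsign) S × 0ᴿ ≤ᴿ value S

    -- Stated for the terms of the sequences, since the reals themselves also carry their proofs of
    -- convergence.
    value-++ : ∀ S S′ n → seq (value (S ++ S′)) n ≡ seq (value S) n ℚ.+ seq (value S′) n
    value-++ []      S′ n = sym (ℚ.+-identityˡ (seq (value S′) n))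
    value-++ (F ∷ S) S′ n =
      trans (cong (seq (contribution F) n ℚ.+_) (value-++ S S′ n))
        (sym (ℚ.+-assoc (seq (contribution F) n) (seq (value S) n) (seq (value S′) n)))

    value-resp : ∀ {S S′} → S ↭ S′ → ∀ n → seq (value S) n ≡ seq (value S′) n
    value-resp ↭.refl          n = refl
    value-resp (↭.prep F p)    n = cong (seq (contribution F) n ℚ.+_) (value-resp p n)
    value-resp {S′ = _ ∷ _ ∷ S′} (↭.swap F F′ p) n = trans
      (cong (λ v → seq (contribution F) n ℚ.+ (seq (contribution F′) n ℚ.+ v)) (value-resp p n))
      (exchange (seq (contribution F) n) (seq (contribution F′) n) (seq (value S′) n))
      where
      exchange : ∀ a b c → a ℚ.+ (b ℚ.+ c) ≡ b ℚ.+ (a ℚ.+ c)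
      exchange = solve 3 (λ a b c → a :+ (b :+ c) := b :+ (a :+ c)) refl
    value-resp (↭.trans p q)   n = trans (value-resp p n) (value-resp q n)

    True-resp : ∀ {S S′} → S ↭ S′ → True S → True S′
    True-resp {S} {S′} p (atoms , 0≤S) =
      ↭.All-resp-↭ p atoms , 0≤ᴿ-resp (value S) (value S′) (value-resp p) 0≤S

    AnyTrue-resp : ∀ {H H′} → H ~ H′ → Any True H → Any True H′
    AnyTrue-resp = ~.Any-resp-↭ True-resp

    -- The two occurrences of `v` contribute opposite amounts, so the values of the halves add up to
    -- the value of `S₁ ++ S₂`, and `0≤ᴿ-split` applies.
    True-split : ∀ v S₁ S₂ → True (S₁ ++ S₂) →
                 ¬ ¬ Any True ((R (sp v) ∷ S₁) ∷ (L (sp v) ∷ S₂) ∷ [])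
    True-split v S₁ S₂ (atoms , 0≤S) no-true = 0≤ᴿ-split
      (value (R (sp v) ∷ S₁)) (value (L (sp v) ∷ S₂)) (value (S₁ ++ S₂)) sum 0≤S λ where
        (inj₁ 0≤) → no-true (here (sp v ∷ All.++⁻ˡ S₁ atoms , 0≤))
        (inj₂ 0≤) → no-true (there (here (sp v ∷ All.++⁻ʳ S₁ atoms , 0≤)))
      where
      cancel : ∀ c a b → a ℚ.+ b ≡ (c ℚ.+ a) ℚ.+ (ℚ.- c ℚ.+ b)
      cancel = solve 3 (λ c a b → a :+ b := (c :+ a) :+ (:- c :+ b)) refl
      sum : ∀ n → seq (value (S₁ ++ S₂)) n ≡
                  seq (value (R (sp v) ∷ S₁)) n ℚ.+ seq (value (L (sp v) ∷ S₂)) n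
      sum n = trans (value-++ S₁ S₂ n)
        (cancel (seq (contribution (R (sp v))) n) (seq (value S₁) n) (seq (value S₂) n))

    multisetValue≡value : ∀ {Γ} (αs : All IsAtom Γ) → multisetValue M ν αs ≡ value (map R Γ)
    multisetValue≡value []       = refl
    multisetValue≡value (α ∷ αs) = cong₂ (λ x y → (x -ᴿ 1ᴿ) +ᴿ y)
      (atomValue≡formulaValue α) (multisetValue≡value αs)
      where
      atomValue≡formulaValue : ∀ {F} (α : IsAtom F) → atomValue M ν α ≡ formulaValue F
      atomValue≡formulaValue (pred P ts) = refl
      atomValue≡formulaValue (const r)   = refl
      atomValue≡formulaValue (sp v)      = refl

    value-L : ∀ Γ n → seq (value (map L Γ)) n ≡ ℚ.- seq (value (map R Γ)) n
    value-L []      n = refl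
    value-L (F ∷ Γ) n = trans (cong (seq (contribution (L F)) n ℚ.+_) (value-L Γ n))
      (sym (ℚ.neg-distrib-+ (seq (contribution (R F)) n) (seq (value (map R Γ)) n)))

    value-sign : ∀ {Γ Δ} (αs : All IsAtom Γ) (βs : All IsAtom Δ) n →
      seq (multisetValue M ν βs -ᴿ multisetValue M ν αs) n ≡ seq (value (sign (Γ , Δ))) n
    value-sign {Γ} {Δ} αs βs n = begin
      seq (multisetValue M ν βs) n ℚ.- seq (multisetValue M ν αs) n
        ≡⟨ cong₂ (λ x y → seq x n ℚ.- seq y n)
             (multisetValue≡value βs) (multisetValue≡value αs) ⟩
      seq (value (map R Δ)) n ℚ.- seq (value (map R Γ)) n
        ≡⟨ ℚ.+-comm (seq (value (map R Δ)) n) (ℚ.- seq (value (map R Γ)) n) ⟩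
      ℚ.- seq (value (map R Γ)) n ℚ.+ seq (value (map R Δ)) n
        ≡⟨ cong (ℚ._+ seq (value (map R Δ)) n) (sym (value-L Γ n)) ⟩
      seq (value (map L Γ)) n ℚ.+ seq (value (map R Δ)) n
        ≡⟨ sym (value-++ (map L Γ) (map R Δ) n) ⟩
      seq (value (sign (Γ , Δ))) n ∎
      where open ≡.≡-Reasoning

    True-sign⁺ : ∀ {S} → TrueAtomic M ν S → True (sign S)
    True-sign⁺ {S} (αs , βs , 0≤S) =
      All.++⁺ (All.map⁺ αs) (All.map⁺ βs) ,
      0≤ᴿ-resp (multisetValue M ν βs -ᴿ multisetValue M ν αs) (value (sign S))
        (value-sign αs βs) 0≤S

    True-sign⁻ : ∀ {S} → True (sign S) → TrueAtomic M ν S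
    True-sign⁻ {Γ , Δ} (atoms , 0≤S) = let αs , βs = All.++⁻ (map L Γ) atoms in
      All.map⁻ αs , All.map⁻ βs ,
      0≤ᴿ-resp (value (sign (Γ , Δ)))
        (multisetValue M ν (All.map⁻ βs) -ᴿ multisetValue M ν (All.map⁻ αs))
        (λ n → sym (value-sign (All.map⁻ αs) (All.map⁻ βs) n)) 0≤S

  module _ (ρ : Renaming) (M : HsInterpretation 𝒮) where
    open HsInterpretation M

    -- The pullback of `M` along `ρ`: a formula gets the value that its renaming has in `M`. As `ρ`
    -- respects kinds, the bounds on semipropositional variables survive.
    renInterpretation : HsInterpretation 𝒮
    renInterpretation = record
      { Domain  = Domain
      ; element = element
      ; ⟦param⟧ = ⟦param⟧ ∘ ρ paramᵏ
      ; ⟦fun⟧   = ⟦fun⟧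
      ; ⟦pred⟧  = ⟦pred⟧
      ; pred≥0  = pred≥0
      ; pred≤1  = pred≤1
      ; ⟦sp⟧    = ⟦sp⟧ ∘ renSP ρ
      ; type0≥0 = type0≥0 ∘ ρ type0ᵏ
      ; type1≤1 = type1≤1 ∘ ρ type1ᵏ
      }

    module _ (ν : Valuation M) where
      private Mρ = renInterpretation

      ⟦renTerm⟧ : ∀ t → ⟦_⟧ᵗ Mρ ν t ≡ ⟦_⟧ᵗ M ν (renTerm (ρ paramᵏ) t)
      ⟦renTerms⟧ : ∀ {n} (ts : Vec (Term 𝒮) n) →
                   ⟦_⟧ᵗˢ Mρ ν ts ≡ ⟦_⟧ᵗˢ M ν (renTerms (ρ paramᵏ) ts)

      ⟦renTerm⟧ (var x)    = refl
      ⟦renTerm⟧ (param a)  = refl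
      ⟦renTerm⟧ (fun f ts) = cong (⟦fun⟧ f) (⟦renTerms⟧ ts)

      ⟦renTerms⟧ []       = refl
      ⟦renTerms⟧ (t ∷ ts) = cong₂ _∷_ (⟦renTerm⟧ t) (⟦renTerms⟧ ts)

      formulaValue-ren : ∀ F → formulaValue Mρ ν F ≡ formulaValue M ν (renFormula ρ F)
      formulaValue-ren (rpl (pred P ts))   = cong (⟦pred⟧ P) (⟦renTerms⟧ ts)
      formulaValue-ren (rpl (const r))     = refl
      formulaValue-ren (rpl (A ⊃ B))       = refl
      formulaValue-ren (rpl (forall′ x A)) = refl
      formulaValue-ren (rpl (exists′ x A)) = refl
      formulaValue-ren (sp v)              = refl

      contribution-ren : ∀ F → contribution Mρ ν F ≡ contribution M ν (ren ρ F)
      contribution-ren (L F) = cong (λ x → -ᴿ (x -ᴿ 1ᴿ)) (formulaValue-ren F)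
      contribution-ren (R F) = cong (_-ᴿ 1ᴿ) (formulaValue-ren F)

      value-ren : ∀ S → value Mρ ν S ≡ value M ν (renSeq ρ S)
      value-ren []      = refl
      value-ren (F ∷ S) = cong₂ _+ᴿ_ (contribution-ren F) (value-ren S)

      atoms-ren : ∀ {S} → All (IsAtom ∘ unsign) S → All (IsAtom ∘ unsign) (renSeq ρ S)
      atoms-ren = All.map⁺ ∘ All.map (renFormula-IsAtom ρ)

      True-ren : ∀ {S} → True Mρ ν S → True M ν (renSeq ρ S)
      True-ren {S} (atoms , 0≤S) = atoms-ren atoms , subst (0ᴿ ≤ᴿ_) (value-ren S) 0≤S

      True-step : ∀ {S Ss} → Step ρ S Ss → True Mρ ν S → ¬ ¬ Any (True M ν) Ss
      True-step rename t no-true = no-true (here (True-ren t))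
      True-step (split {S₁} {S₂} v p) t =
        True-split M ν v (renSeq ρ S₁) (renSeq ρ S₂)
          (subst (True M ν) (List.map-++ (ren ρ) S₁ S₂) (True-ren (True-resp Mρ ν p t)))
      -- A true sequent is atomic, hence cannot contain the compound formula being inverted.
      True-step (invert i det p red) (atoms , _) no-true =
        Reduction-nonatomic red (renFormula-IsAtom ρ (All.head (↭.All-resp-↭ p atoms)))

  -- Axioms and derivations of bounded height

  IsAxiomS : HSeq → Set₁
  IsAxiomS H = ∀ M (ν : Valuation M) → ¬ ¬ Any (True M ν) H

  IsAxiomS-resp : ∀ {H H′} → H ~ H′ → IsAxiomS H → IsAxiomS H′
  IsAxiomS-resp p ax M ν no-true = ax M ν (no-true ∘ AnyTrue-resp M ν p)

  -- The source has a true sequent under the pulled-back interpretation. Either the step acts on it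
  -- and yields a true sequent, or its renaming is a true sequent of the context.
  IsAxiomS-transforms : ∀ {ρ H H′} → Transforms ρ H H′ → IsAxiomS H → IsAxiomS H′
  IsAxiomS-transforms {ρ} (transforms {S} {G} {Ss} X source step target) ax M ν no-true =
    ax Mρ ν λ t → case (AnyTrue-resp Mρ ν source t)
    where
    Mρ = renInterpretation ρ M
    no-true′ : ¬ Any (True M ν) (Ss ++ (renH ρ G ++ X))
    no-true′ = no-true ∘ AnyTrue-resp M ν (~.↭-sym target)
    case : ¬ Any (True Mρ ν) (S ∷ G)
    case (here t)  = True-step ρ M ν step t (no-true′ ∘ Any.++⁺ˡ)
    case (there t) = no-true′ (Any.++⁺ʳ Ss (Any.++⁺ˡ (Any.map⁺ (Any.map (True-ren ρ M ν) t))))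

  -- In the `Hit` case this identifies the result of the inversion with a renamed and weakened
  -- premise that is already derived.
  renH-premise : ∀ {ρ} ρ′ c {S G} X → Agree ρ ρ′ S → All (Agree ρ ρ′) G →
    premise (renChange ρ′ c) (renSeq ρ S) [] ++ (renH ρ G ++ X) ≡
    renH ρ′ (premise c S G) ++ X
  renH-premise {ρ} ρ′ (Φ , E) {S} {G} X agS agG = cong₂ _∷_
    (sym (renSeq-++-agree ρ′ Φ agS))
    (trans (cong (_++ (renH ρ G ++ X)) (List.++-identityʳ (renH ρ′ E)))
    (trans (sym (List.++-assoc (renH ρ′ E) (renH ρ G) X))
           (cong (_++ X) (sym (renH-++-agree ρ′ E agG)))))

  -- The index bounds the height from above, so height preservation is built into the types.
  -- Exchange is absorbed into each inference.
  data Derivation : ℕ → HSeq → Set₁ where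
    ax    : ∀ {n H} → IsAxiomS H → Derivation n H
    infer : ∀ {n r k e F cs S G H} → Reduction r k e F cs → Fresh k e ((F ∷ S) ∷ G) →
            H ~ (F ∷ S) ∷ G → (∀ i → Derivation n (premise (lookup cs i) S G)) →
            Derivation (suc n) H

  Derivation-resp : ∀ {n H H′} → H ~ H′ → Derivation n H → Derivation n H′
  Derivation-resp p (ax a)              = ax (IsAxiomS-resp p a)
  Derivation-resp p (infer red fr q ds) = infer red fr (~.↭-trans (~.↭-sym p) q) ds

  Derivation-suc : ∀ {n H} → Derivation n H → Derivation (suc n) H
  Derivation-suc (ax a)              = ax a
  Derivation-suc (infer red fr p ds) = infer red fr p (Derivation-suc ∘ ds)

  -- The main induction: renaming, weakening, splitting and inversion

  module HSeqSolver = CommutativeMonoidSolver ~.++-commutativeMonoid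
  open HSeqSolver using (_⊕_; _⊜_)

  -- The eigenvariable e of the last inference is sent to some e′ fresh for H′, which is
  -- why the renaming ρ must vary in the induction.
  transform : ∀ {n ρ H H′} → Transforms ρ H H′ → Derivation n H → Derivation n H′
  transform t (ax a) = ax (IsAxiomS-transforms t a)
  transform {ρ = ρ} {H′ = H′} (transforms {S} {G} {Ss} X source step target)
    (infer {n} {r} {k} {e} {F} {cs} {S₀} {G₀} red fr p ds)
    with e∉F , e∉S₀ , e∉G₀ ← Fresh-uncons k e fr
    with ∷-↭-inv seqSetoid (~.↭-trans (~.↭-sym p) source)
  -- The step acts on the principal sequent of the last inference.
  ... | inj₁ (FS₀↭S , G₀~G) = case (progress (↭-sym FS₀↭S) step)
    where
    target′ : H′ ~ Ss ++ (renH ρ G₀ ++ X)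
    target′ = ~.↭-trans target (~.++⁺ˡ Ss (~.++⁺ʳ X (renH-resp ρ (~.↭-sym G₀~G))))
    case : Pass ρ F S₀ Ss ⊎ Hit ρ F S₀ Ss → Derivation (suc n) H′
    -- The inference is repeated below the step, on the sequent that still contains `F`; the
    -- continued step is applied to its premises by induction.
    case (inj₁ (pass {rest} {others} focus continue)) =
      infer (Reduction-update ρ red e∉F e′)
        (Fresh-resp k e′ target″ fr′) target″ premises
      where
      e′ = proj₁ (fresh k H′)
      fr′ = proj₂ (fresh k H′)
      ρ′ = ρ [ k , e ↦ e′ ]
      target″ : H′ ~ (ren ρ F ∷ rest) ∷ (others ++ (renH ρ G₀ ++ X))
      target″ = ~.↭-trans target′ (~.++⁺ʳ (renH ρ G₀ ++ X) focus)
      premises : ∀ i → Derivation n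
        (premise (lookup (Vec.map (renChange ρ′) cs) i) rest (others ++ (renH ρ G₀ ++ X)))
      premises i rewrite Vec.lookup-map i (renChange ρ′) cs
        with Φ , E ← lookup cs i | d ← ds i
        with Ss′ , step′ , focus′ ← continue ρ′ Φ (Agree-update ρ k e e′ S₀ e∉S₀) =
        transform (transforms X ~.↭-refl step′ (~.↭-trans
          -- For the induction hypothesis, the sequents `E` added by the rule count as context, and
          -- `others` as produced by the step.
          (HSeqSolver.solve 5 (λ a b c g x → a ⊕ (b ⊕ (c ⊕ (g ⊕ x))) ⊜ (a ⊕ c) ⊕ ((b ⊕ g) ⊕ x))
            ~.↭-refl ((renSeq ρ′ Φ ++ rest) ∷ []) (renH ρ′ E) others (renH ρ G₀) X)
          (~.++⁺ (~.↭-sym focus′) (~.++⁺ʳ X (~.↭-reflexive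
            (sym (renH-++-agree ρ′ E (AgreeH-update ρ k e e′ G₀ e∉G₀))))))))
          d
    -- The last inference introduced the inverted occurrence. Renaming its premise so that `e`
    -- becomes the requested `e′` gives the goal with one inference fewer, hence `Derivation-suc`.
    case (inj₂ (hit {e = e′} {cs′} i det red′ focus))
      with j , eq ← Reduction-deterministic (ρ [ k , e ↦ e′ ]) red det
             (subst (λ F → Reduction _ _ e′ F cs′) (ren-update ρ k e e′ F e∉F) red′)
             (update-same ρ k e e′) i
      rewrite eq =
      Derivation-suc (transform
        (transforms X ~.↭-refl rename (~.↭-trans target′ (~.↭-trans
          (~.++⁺ʳ (renH ρ G₀ ++ X) focus)
          (~.↭-reflexive (renH-premise (ρ [ k , e ↦ e′ ]) (lookup cs j) X
            (Agree-update ρ k e e′ S₀ e∉S₀)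
            (AgreeH-update ρ k e e′ G₀ e∉G₀))))))
        (ds j))
  -- The step acts on a sequent `S` of the context. As `e` does not occur in `S`, the same step is
  -- available under `ρ′`; it is applied to the premises and the inference is repeated.
  ... | inj₂ (G₁ , G₀~ , G~) =
    infer (Reduction-update ρ red e∉F e′) (Fresh-resp k e′ target′ fr′) target′ premises
    where
    e′ = proj₁ (fresh k H′)
    fr′ = proj₂ (fresh k H′)
    ρ′ = ρ [ k , e ↦ e′ ]
    target′ : H′ ~ (ren ρ F ∷ renSeq ρ S₀) ∷ (Ss ++ (renH ρ G₁ ++ X))
    target′ = ~.↭-trans target (~.↭-trans (~.++⁺ˡ Ss (~.++⁺ʳ X (renH-resp ρ G~)))
      (~.↭-shift Ss (renH ρ G₁ ++ X)))
    premises : ∀ i → Derivation n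
      (premise (lookup (Vec.map (renChange ρ′) cs) i) (renSeq ρ S₀) (Ss ++ (renH ρ G₁ ++ X)))
    premises i rewrite Vec.lookup-map i (renChange ρ′) cs
      with Φ , E ← lookup cs i | d ← ds i
      with agS ∷ agG₁ ← AgreeH-update ρ k e e′ (S ∷ G₁) (Fresh-resp k e G₀~ e∉G₀) =
      transform (transforms X
        (~.↭-trans (~.++⁺ˡ ((Φ ++ S₀) ∷ E) G₀~) (~.↭-shift ((Φ ++ S₀) ∷ E) G₁))
        (Step-agree agS step)
        (~.↭-trans
          (HSeqSolver.solve 5 (λ a b c g x → a ⊕ (b ⊕ (c ⊕ (g ⊕ x))) ⊜ c ⊕ ((a ⊕ (b ⊕ g)) ⊕ x))
            ~.↭-refl ((renSeq ρ′ Φ ++ renSeq ρ S₀) ∷ []) (renH ρ′ E) Ss (renH ρ G₁) X)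
          (~.++⁺ˡ Ss (~.++⁺ʳ X (~.↭-reflexive (sym (cong₂ _∷_
            (renSeq-++-agree ρ′ Φ (Agree-update ρ k e e′ S₀ e∉S₀))
            (renH-++-agree ρ′ E agG₁))))))))
        d

  -- Translation between proofs and signed derivations

  lefts rights : Seq → List (Formula 𝒮)
  lefts []       = []
  lefts (L F ∷ S) = F ∷ lefts S
  lefts (R F ∷ S) = lefts S
  rights []       = []
  rights (L F ∷ S) = rights S
  rights (R F ∷ S) = F ∷ rights S

  unsignSeq : Seq → Sequent 𝒮
  unsignSeq S = lefts S , rights S

  signH : Hypersequent 𝒮 → HSeq
  signH = map sign

  unsignH : HSeq → Hypersequent 𝒮
  unsignH = map unsignSeq

  sign-∷-right : ∀ Γ F Δ → sign (Γ , F ∷ Δ) ↭ R F ∷ sign (Γ , Δ)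
  sign-∷-right Γ F Δ = ↭.shift (R F) (map L Γ) (map R Δ)

  sign-unsignSeq : ∀ S → sign (unsignSeq S) ↭ S
  sign-unsignSeq []        = ↭.refl
  sign-unsignSeq (L F ∷ S) = ↭-prep (L F) (sign-unsignSeq S)
  sign-unsignSeq (R F ∷ S) =
    ↭-trans (sign-∷-right (lefts S) F (rights S)) (↭-prep (R F) (sign-unsignSeq S))

  lefts-resp : ∀ {S S′} → S ↭ S′ → lefts S ↭ lefts S′
  lefts-resp ↭.refl                 = ↭.refl
  lefts-resp (↭.prep (L F) p)       = ↭-prep F (lefts-resp p)
  lefts-resp (↭.prep (R F) p)       = lefts-resp p
  lefts-resp (↭.swap (L F) (L E) p) = ↭-swap F E (lefts-resp p)
  lefts-resp (↭.swap (L F) (R E) p) = ↭-prep F (lefts-resp p)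
  lefts-resp (↭.swap (R F) (L E) p) = ↭-prep E (lefts-resp p)
  lefts-resp (↭.swap (R F) (R E) p) = lefts-resp p
  lefts-resp (↭.trans p q)          = ↭-trans (lefts-resp p) (lefts-resp q)

  rights-resp : ∀ {S S′} → S ↭ S′ → rights S ↭ rights S′
  rights-resp ↭.refl                 = ↭.refl
  rights-resp (↭.prep (L F) p)       = rights-resp p
  rights-resp (↭.prep (R F) p)       = ↭-prep F (rights-resp p)
  rights-resp (↭.swap (L F) (L E) p) = rights-resp p
  rights-resp (↭.swap (L F) (R E) p) = ↭-prep E (rights-resp p)
  rights-resp (↭.swap (R F) (L E) p) = ↭-prep F (rights-resp p)
  rights-resp (↭.swap (R F) (R E) p) = ↭-swap F E (rights-resp p)
  rights-resp (↭.trans p q)          = ↭-trans (rights-resp p) (rights-resp q)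

  lefts-sign : ∀ Γ Δ → lefts (sign (Γ , Δ)) ≡ Γ
  lefts-sign []      []      = refl
  lefts-sign []      (F ∷ Δ) = lefts-sign [] Δ
  lefts-sign (F ∷ Γ) Δ       = cong (F ∷_) (lefts-sign Γ Δ)

  rights-sign : ∀ Γ Δ → rights (sign (Γ , Δ)) ≡ Δ
  rights-sign []      []      = refl
  rights-sign []      (F ∷ Δ) = cong (F ∷_) (rights-sign [] Δ)
  rights-sign (F ∷ Γ) Δ       = rights-sign Γ Δ

  module ≋ = PermutationSetoid (sequentSetoid 𝒮)

  unsignH-signH : ∀ H → unsignH (signH H) ≡ H
  unsignH-signH []            = refl
  unsignH-signH ((Γ , Δ) ∷ H) =
    cong₂ _∷_ (cong₂ _,_ (lefts-sign Γ Δ) (rights-sign Γ Δ)) (unsignH-signH H)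

  signH-unsignH : ∀ H → signH (unsignH H) ~ H
  signH-unsignH []      = ~.↭-refl
  signH-unsignH (S ∷ H) = ~.prep (sign-unsignSeq S) (signH-unsignH H)

  signH-resp : ∀ {H H′} → H ≋ H′ → signH H ~ signH H′
  signH-resp = PermutationSetoidProperties.map⁺ (sequentSetoid 𝒮) seqSetoid
    λ (p , q) → ↭.++⁺ (↭.map⁺ L p) (↭.map⁺ R q)

  unsignH-resp : ∀ {H H′} → H ~ H′ → unsignH H ≋ unsignH H′
  unsignH-resp = ~.map⁺ (sequentSetoid 𝒮) λ p → lefts-resp p , rights-resp p

  unsignH-adjoint : ∀ {H H′} → signH H ~ H′ → H ≋ unsignH H′
  unsignH-adjoint {H} {H′} p = subst (_≋ unsignH H′) (unsignH-signH H) (unsignH-resp p)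

  module _ (P : Formula 𝒮 → Set) where

    Any-lefts : ∀ S → Any P (lefts S) → Any (P ∘ unsign) S
    Any-lefts (L F ∷ S) (here p)  = here p
    Any-lefts (L F ∷ S) (there p) = there (Any-lefts S p)
    Any-lefts (R F ∷ S) p         = there (Any-lefts S p)

    Any-rights : ∀ S → Any P (rights S) → Any (P ∘ unsign) S
    Any-rights (L F ∷ S) p         = there (Any-rights S p)
    Any-rights (R F ∷ S) (here p)  = here p
    Any-rights (R F ∷ S) (there p) = there (Any-rights S p)

    Somewhere-unsignH : ∀ {H} → Somewhere P (unsignH H) → Any (Any (P ∘ unsign)) H
    Somewhere-unsignH = Any.map [ Any-lefts _ , Any-rights _ ]′ ∘ Any.map⁻

    Somewhere-signH : ∀ {H} → Any (Any (P ∘ unsign)) (signH H) → Somewhere P H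
    Somewhere-signH = Any.map (λ {(Γ , Δ)} p →
      Sum.map Any.map⁻ Any.map⁻ (Any.++⁻ (map L Γ) p)) ∘ Any.map⁻

  -- Permutations take the place of equalities because `sign` puts a principal formula of the
  -- succedent behind the whole antecedent.
  record Decoded (r : G³Ł∀Rule) (Hs : Vec (Hypersequent 𝒮) (G³Ł∀-arity r))
                 (H : Hypersequent 𝒮) : Set where
    constructor decoded
    field
      {k}        : Kind
      {e}        : ℕ
      {F}        : SignedFormula
      {S}        : Seq
      {G}        : HSeq
      {cs}       : Vec Change (G³Ł∀-arity r)
      red        : Reduction r k e F cs
      isFresh    : Fresh k e (signH H)
      conclusion : signH H ~ (F ∷ S) ∷ G
      premises   : ∀ i → signH (lookup Hs i) ~ premise (lookup cs i) S G

  decode : ∀ {r Hs H} → Schema r Hs H → Decoded r Hs H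
  decode (→⇒ G Γ Δ A B p p♯) =
    decoded (→⇒ p) (p♯ ∘ Somewhere-signH _) ~.↭-refl λ { zero → ~.↭-refl }
  -- This rule has no eigenvariable; a fresh parameter serves as the dummy.
  decode {H = H} (⇒→ G Γ Δ A B) = let a , a♯ = fresh paramᵏ (signH H) in
    decoded (⇒→ a) a♯ (~.prep (sign-∷-right Γ _ Δ) ~.↭-refl) λ where
      zero       → ~.↭-refl
      (suc zero) → ~.prep (↭-prep _ (sign-∷-right Γ _ Δ)) ~.↭-refl
  decode (∀⇒ G Γ Δ x A t p cl p♯) =
    decoded (∀⇒ p cl) (p♯ ∘ Somewhere-signH _) ~.↭-refl λ { zero → ~.↭-refl }
  decode (⇒∀ G Γ Δ x A a a♯) =
    decoded (⇒∀ a) (a♯ ∘ Somewhere-signH _) (~.prep (sign-∷-right Γ _ Δ) ~.↭-refl)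
      λ { zero → ~.prep (sign-∷-right Γ _ Δ) ~.↭-refl }
  decode (⇒∃ G Γ Δ x A t q cl q♯) =
    decoded (⇒∃ q cl) (q♯ ∘ Somewhere-signH _) (~.prep (sign-∷-right Γ _ Δ) ~.↭-refl)
      λ { zero → ~.prep (sign-∷-right Γ _ Δ) ~.↭-refl }
  decode (∃⇒ G Γ Δ x A a a♯) =
    decoded (∃⇒ a) (a♯ ∘ Somewhere-signH _) ~.↭-refl λ { zero → ~.↭-refl }

  encode : ∀ {r k e F cs S G} → Reduction r k e F cs → Fresh k e ((F ∷ S) ∷ G) →
    Schema r (Vec.map (λ c → unsignH (premise c S G)) cs) (unsignH ((F ∷ S) ∷ G))
  encode {S = S} {G} (→⇒ p) fr =
    →⇒ (unsignH G) (lefts S) (rights S) _ _ p (fr ∘ Somewhere-unsignH _)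
  encode {S = S} {G} (⇒→ a) fr =
    ⇒→ (unsignH G) (lefts S) (rights S) _ _
  encode {S = S} {G} (∀⇒ p cl) fr =
    ∀⇒ (unsignH G) (lefts S) (rights S) _ _ _ p cl (fr ∘ Somewhere-unsignH _)
  encode {S = S} {G} (⇒∀ a) fr =
    ⇒∀ (unsignH G) (lefts S) (rights S) _ _ a (fr ∘ Somewhere-unsignH _)
  encode {S = S} {G} (⇒∃ q cl) fr =
    ⇒∃ (unsignH G) (lefts S) (rights S) _ _ _ q cl (fr ∘ Somewhere-unsignH _)
  encode {S = S} {G} (∃⇒ a) fr =
    ∃⇒ (unsignH G) (lefts S) (rights S) _ _ a (fr ∘ Somewhere-unsignH _)

  𝒞 : Calculus 𝒮
  𝒞 = G³Ł∀ 𝒮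

  toDerivation : ∀ {n H} (D : Proof 𝒞 H) → height 𝒞 D ℕ.≤ n → Derivation n (signH H)
  toDerivations : ∀ {n k} {Hs : Vec (Hypersequent 𝒮) k} (Ds : VecAll.All (Proof 𝒞) Hs) →
                  maxHeight 𝒞 Ds ℕ.≤ n → ∀ i → Derivation n (signH (lookup Hs i))

  toDerivation (Proof.axiom a) _ =
    ax λ M ν no-true → a M ν (no-true ∘ Any.map⁺ ∘ Any.map (True-sign⁺ M ν))
  toDerivation (Proof.infer r (Hs′ , H′ , schema , Hs≋ , H≋) Ds) (ℕ.s≤s h≤) =
    let d = decode schema
        open Decoded d
    in infer red (Fresh-resp k e conclusion isFresh) (~.↭-trans (signH-resp H≋) conclusion)
         λ i → Derivation-resp (~.↭-trans (signH-resp (Pointwise.lookup Hs≋ i)) (premises i))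
                 (toDerivations Ds h≤ i)

  toDerivations (D ∷ Ds) h≤ zero    = toDerivation D (ℕ.m⊔n≤o⇒m≤o _ _ h≤)
  toDerivations (D ∷ Ds) h≤ (suc i) = toDerivations Ds (ℕ.m⊔n≤o⇒n≤o _ _ h≤) i

  ProofOfHeight≤ : ℕ → Hypersequent 𝒮 → Set₁
  ProofOfHeight≤ n H = Σ (Proof 𝒞 H) λ D → height 𝒞 D ℕ.≤ n

  tabulateProofs : ∀ {n k} (Hs : Vec (Hypersequent 𝒮) k) →
    (∀ i → ProofOfHeight≤ n (lookup Hs i)) →
    Σ (VecAll.All (Proof 𝒞) Hs) λ Ds → maxHeight 𝒞 Ds ℕ.≤ n
  tabulateProofs []       Ds = [] , ℕ.z≤n
  tabulateProofs (H ∷ Hs) Ds =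
    let D , h≤ = Ds zero
        Ds′ , h≤′ = tabulateProofs Hs (Ds ∘ suc)
    in D ∷ Ds′ , ℕ.⊔-lub h≤ h≤′

  -- Permuting costs no height: validity of axioms is invariant, and `OnMultisets` lets an inference
  -- conclude any representative of its multiset.
  fromDerivation : ∀ {n H H₀} → Derivation n H → signH H₀ ~ H → ProofOfHeight≤ n H₀
  fromDerivation (ax a) p = Proof.axiom (λ M ν no-true → IsAxiomS-resp (~.↭-sym p) a M ν
    (no-true ∘ Any.map (True-sign⁻ M ν) ∘ Any.map⁻)) , ℕ.z≤n
  fromDerivation {n = suc n} (infer {r = r} {cs = cs} {S} {G} red fr q ds) p =
    let Ds , h≤ = tabulateProofs Hs λ i →
          subst (ProofOfHeight≤ n) (sym (Vec.lookup-map i _ cs))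
            (fromDerivation (ds i) (signH-unsignH (premise (lookup cs i) S G)))
    in Proof.infer r (Hs , _ , encode red fr , Pointwise.refl ≋.↭-refl ,
         unsignH-adjoint (~.↭-trans p q)) Ds , ℕ.s≤s h≤
    where
    Hs = Vec.map (λ c → unsignH (premise c S G)) cs

  -- Inversion of the six rules

  splitDerivation : ∀ {n} v S₁ S₂ G X → Derivation n ((S₁ ++ S₂) ∷ G) →
    Derivation n ((R (sp v) ∷ S₁) ∷ (L (sp v) ∷ S₂) ∷ G ++ X)
  splitDerivation v S₁ S₂ G X = transform (transforms X ~.↭-refl (split v ↭.refl)
    (~.↭-reflexive (cong₂ _∷_ (cong (_ ∷_) (sym (renSeq-id S₁)))
      (cong₂ _∷_ (cong (_ ∷_) (sym (renSeq-id S₂))) (cong (_++ X) (sym (renH-id G)))))))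

  invertDerivation : ∀ {n r k e F cs S G} → Deterministic r → Reduction r k e F cs → ∀ i →
    Derivation n ((F ∷ S) ∷ G) → Derivation n (premise (lookup cs i) S G)
  invertDerivation {F = F} {cs} {S} {G} det red i = transform (transforms [] ~.↭-refl
    (invert i det ↭.refl (subst (λ F → Reduction _ _ _ F cs) (sym (ren-id F)) red))
    (~.↭-reflexive (cong₂ _∷_ (cong (Φ ++_) (sym (renSeq-id S)))
      (cong₂ _++_ (sym (List.++-identityʳ E))
        (trans (sym (renH-id G)) (sym (List.++-identityʳ (renH idʳ G))))))))
    where
    Φ = proj₁ (lookup cs i)
    E = proj₂ (lookup cs i)

  invertPremise : ∀ {n r k e F cs S G} → Reduction r k e F cs → ∀ i →
    Derivation n ((F ∷ S) ∷ G) → Derivation n (premise (lookup cs i) S G)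
  invertPremise red@(→⇒ _) i = invertDerivation tt red i
  invertPremise red@(⇒→ _) i = invertDerivation tt red i
  invertPremise red@(⇒∀ _) i = invertDerivation tt red i
  invertPremise red@(∃⇒ _) i = invertDerivation tt red i
  -- Splitting off the quantified formula yields the first two sequents of the premise; the one with
  -- the instance for `t` comes from weakening.
  invertPremise {F = F} {S = S} {G} (∀⇒ {x} {A} {t} p _) zero d =
    Derivation-resp (~.swap (↭-swap _ _ ↭.refl) ↭.refl (~.++-comm G _))
      (splitDerivation (type1 p) (F ∷ []) S G
        ((L (rpl (A [ x ≔ t ])) ∷ R (sp (type1 p)) ∷ []) ∷ []) d)
  -- Dually, the existential formula must join the antecedent occurrence of `q`, so it forms the
  -- second half of the split.
  invertPremise {F = F} {S = S} {G} (⇒∃ {x} {A} {t} q _) zero d =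
    Derivation-resp (~.prep ↭.refl (~.prep ↭.refl (~.++-comm G _)))
      (splitDerivation (type0 q) S (F ∷ []) G
        ((L (sp (type0 q)) ∷ R (rpl (A [ x ≔ t ])) ∷ []) ∷ [])
        (Derivation-resp (~.prep (↭.++-comm (F ∷ []) S) ~.↭-refl) d))

  invertible : (r : G³Ł∀Rule) → HpInvertible 𝒞 (Calculus.rule 𝒞 r)
  invertible r i {H₀ ∷ []} (Hs , (Hs′ , H′ , schema , Hs≋ , H₀≋) , refl) (D ∷ []) =
    let open Decoded (decode schema)
        d = invertPremise red i (Derivation-resp (~.↭-trans (signH-resp H₀≋) conclusion)
              (toDerivation D ℕ.≤-refl))
        D′ , h≤ = fromDerivation d (~.↭-trans (signH-resp (Pointwise.lookup Hs≋ i)) (premises i))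
    in D′ , ℕ.≤-trans h≤ (ℕ.m≤m⊔n _ 0)

lemma4 : (𝒮 : Signature) (r : G³Ł∀Rule) → HpInvertible (G³Ł∀ 𝒮) (Calculus.rule (G³Ł∀ 𝒮) r)
lemma4 = Signed.invertible
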